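{- Let $n=4k+\alpha$ with $k$ a positive integer and $\alpha\in\{0,1,2,3\}$, and let $G$ be a uniformly most reliable graph in ${\cal H}(n,n+2)$. Then $G$ is isomorphic to the graph of type A with vector of c-path lengths $(k,k,k,k)$ if $\alpha=0$; $(k+1,k,k,k)$ if $\alpha=1$; $(k+1,k,k+1,k)$ if $\alpha=2$; $(k+1,k+1,k+1,k)$ if $\alpha=3$.
   Context: All graphs are finite and simple. ${\cal H}(n,m)$ is the set of (pairwise non-isomorphic) hamiltonian graphs with $n$ vertices and $m$ edges. For a connected graph $G=(V,E)$ with $m$ edges, $\mathrm{Rel}(G,p)=\sum_{i=0}^m N_i p^i(1-p)^{m-i}$, where $N_i$ is the number of subsets $N\subseteq E$ with $|N|=i$ such that $(V,N)$ is connected (the probability that $G$ stays connected when each edge independently survives with probability $p$). $G$ is uniformly most reliable in ${\cal H}(n,m)$ if $G\in{\cal H}(n,m)$ and $\mathrm{Rel}(G,p)\geq\mathrm{Rel}(H,p)$ for all $p\in[0,1]$ and all $H\in{\cal H}(n,m)$. Given nonnegative integers $x_1,x_2,x_3,x_4$ summing to $n$, the graph of type A with vector of c-path lengths $(x_1,x_2,x_3,x_4)$ is obtained from the cycle with vertices $0,1,\dots,n-1$ (in this cyclic order) by adding the two crossing chords $\{0,x_1+x_2\}$ and $\{x_1,x_1+x_2+x_3\}$ (labels modulo $n$); its chord endpoints split the hamiltonian cycle into consecutive paths of lengths $x_1,x_2,x_3,x_4$. -}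

module Defs where

open import Data.Nat as ℕ using (ℕ; zero; suc; _∸_)
open import Data.Nat.DivMod using (_%_)
open import Data.Fin as Fin using (Fin; toℕ)
open import Data.Bool using (Bool; true; false; _∧_; _∨_; if_then_else_)
open import Data.Product using (_×_; _,_; proj₁; proj₂; Σ; ∃)
open import Data.Sum using (_⊎_)
open import Data.List using (List; []; _∷_; _++_; [_]; length; map; allFin; foldr)
open import Data.Bool.ListAction using (all; any)
open import Data.List.Relation.Unary.All using (All)
open import Data.List.Relation.Unary.Unique.Propositional using (Unique)
open import Data.List.Membership.Propositional using (_∈_)
open import Data.List.Relation.Binary.Permutation.Propositional using (_↭_)
open import Data.Rational as ℚ using (ℚ; 0ℚ; 1ℚ; _-_)
open import Function.Bundles using (_↔_; Inverse; _⇔_)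
open import Relation.Binary.PropositionalEquality using (_≡_)

-- Finite simple graphs on the vertex set Fin n.
-- An edge {u,v} is stored once, as the ordered pair (u , v) with u < v;
-- the edge list has no repetitions.  Hence no loops, no multi-edges.

record Graph (n : ℕ) : Set where
  field
    edges   : List (Fin n × Fin n)
    ordered : All (λ e → proj₁ e Fin.< proj₂ e) edges
    nodup   : Unique edges
open Graph public

∣E∣ : ∀ {n} → Graph n → ℕ
∣E∣ G = length (edges G)

Adj : ∀ {n} → Graph n → Fin n → Fin n → Set
Adj G u v = ((u , v) ∈ edges G) ⊎ ((v , u) ∈ edges G)

consecAdj : ∀ {n} → Graph n → List (Fin n) → Set
consecAdj G []           = Data.Unit.⊤ where import Data.Unit
consecAdj G (u ∷ [])     = Data.Unit.⊤ where import Data.Unit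
consecAdj G (u ∷ v ∷ vs) = Adj G u v × consecAdj G (v ∷ vs)

closesCycle : ∀ {n} → Graph n → List (Fin n) → Set
closesCycle G []       = Data.Empty.⊥ where import Data.Empty
closesCycle G (u ∷ vs) = consecAdj G (u ∷ vs ++ [ u ])

Hamiltonian : ∀ {n} → Graph n → Set
Hamiltonian {n} G =
  (3 ℕ.≤ n) × Σ (List (Fin n)) (λ c → (c ↭ allFin n) × closesCycle G c)

-- Connectivity of a spanning subgraph (V , N), N a list of edges.
-- reach N k v : v is reachable from vertex 0 by a walk of length ≤ k
-- using edges of N (computed by breadth-first closure).
-- (V , N) is connected iff every vertex is reachable from vertex 0 within
-- n steps (walks of length ≤ n - 1 suffice); the graph with n = 0 vertices
-- is (conventionally) connected.

module _ {n : ℕ} where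
  _==_ : Fin n → Fin n → Bool
  u == v = toℕ u ℕ.≡ᵇ toℕ v

reach : ∀ {n} → List (Fin (suc n) × Fin (suc n)) → ℕ → Fin (suc n) → Bool
reach N zero    v = v == Fin.zero
reach N (suc k) v =
  reach N k v ∨
  any (λ e → (reach N k (proj₁ e) ∧ (proj₂ e == v))
           ∨ (reach N k (proj₂ e) ∧ (proj₁ e == v))) N

connected? : ∀ n → List (Fin n × Fin n) → Bool
connected? zero    N = true
connected? (suc n) N = all (reach N (suc n)) (allFin (suc n))

subsets : ∀ {A : Set} → List A → List (List A)
subsets []       = [] ∷ []
subsets (x ∷ xs) = subsets xs ++ map (x ∷_) (subsets xs)

_^_ : ℚ → ℕ → ℚ
p ^ zero  = 1ℚ
p ^ suc k = p ℚ.* (p ^ k)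

Rel : ∀ {n} → Graph n → ℚ → ℚ
Rel {n} G p =
  foldr ℚ._+_ 0ℚ
    (map (λ N → if connected? n N
                  then (p ^ length N) ℚ.* ((1ℚ - p) ^ (∣E∣ G ∸ length N))
                  else 0ℚ)
         (subsets (edges G)))

UniformlyMostReliable : ∀ {n} → ℕ → Graph n → Set
UniformlyMostReliable {n} m G =
  (Hamiltonian G × ∣E∣ G ≡ m) ×
  ((H : Graph n) → Hamiltonian H → ∣E∣ H ≡ m →
     (p : ℚ) → 0ℚ ℚ.≤ p → p ℚ.≤ 1ℚ → Rel H p ℚ.≤ Rel G p)

-- Graph of type A with c-path length vector (x₁,x₂,x₃,x₄), n = x₁+x₂+x₃+x₄,
-- given by its adjacency relation on vertices 0,…,n-1: the cycle
-- 0-1-…-(n-1)-0 plus chords {0, x₁+x₂} and {x₁, x₁+x₂+x₃} (labels mod n).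

modn : ℕ → ℕ → ℕ
modn zero    a = a
modn (suc n) a = a % suc n

TypeAAdj : (n : ℕ) → ℕ × ℕ × ℕ × ℕ → Fin n → Fin n → Set
TypeAAdj n (x₁ , x₂ , x₃ , x₄) u v =
    cyc u v ⊎ cyc v u ⊎ chord 0 (x₁ ℕ.+ x₂) ⊎ chord x₁ (x₁ ℕ.+ x₂ ℕ.+ x₃)
  where
    cyc : Fin n → Fin n → Set
    cyc a b = (toℕ b ≡ suc (toℕ a)) ⊎ ((toℕ a ≡ n ∸ 1) × (toℕ b ≡ 0))
    chord : ℕ → ℕ → Set
    chord a b = ((toℕ u ≡ modn n a) × (toℕ v ≡ modn n b))
              ⊎ ((toℕ v ≡ modn n a) × (toℕ u ≡ modn n b))

IsoTo : ∀ {n} → Graph n → (Fin n → Fin n → Set) → Set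
IsoTo {n} G R = Σ (Fin n ↔ Fin n) λ f →
  ∀ u v → Adj G u v ⇔ R (Inverse.to f u) (Inverse.to f v)

cpaths : ℕ → Fin 4 → ℕ × ℕ × ℕ × ℕ
cpaths k Fin.zero                         = (k , k , k , k)
cpaths k (Fin.suc Fin.zero)               = (suc k , k , k , k)
cpaths k (Fin.suc (Fin.suc Fin.zero))     = (suc k , k , suc k , k)
cpaths k (Fin.suc (Fin.suc (Fin.suc _)))  = (suc k , suc k , suc k , k)

module Submission where

-- At p = 1/2 the reliability is 2^-m times the number of connected spanning subgraphs, so a
-- uniformly most reliable graph maximises that number.  Let a hamiltonian graph be a cycle of
-- length n with two chords.  In the cographic matroid over F₂ the cycle edge i is the vector
-- (1,α,β), where α and β tell on which side of the chords i lies; a set of removed edges leaves a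
-- connected graph exactly when it is independent.  Among these four vectors the only linear
-- relation is that all four add up to 0, so the number of connected subgraphs is
-- Π(1+x) - Πx summed over the subsets of kept chords, where x runs over the sizes of the classes
-- that the kept chords distinguish.  This is a polynomial in the sizes of the four classes, and the
-- chords cross exactly when no class is empty.  Completing squares shows that the polynomial is
-- maximal only at the rotations of the stated vectors.

open import Defs
open import Algebra.Bundles using (CommutativeRing)
import Algebra.Properties.CommutativeSemigroup as CommutativeSemigroupₚ
open import Data.Bool using (Bool; true; false; _∧_; _∨_; not; _xor_; if_then_else_)
open import Data.Bool.ListAction using (all; any)
open import Data.Bool.Properties as Boolₚ
  using (∧-identityʳ; ∧-zeroʳ; ∨-zeroʳ; xor-assoc; xor-comm; xor-identityʳ; xor-same; T-≡)
open import Data.Empty using (⊥; ⊥-elim)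
open import Data.Fin as Fin using (Fin; toℕ; fromℕ<)
import Data.Fin.Properties as Finₚ
open import Data.List
  using (List; []; _∷_; _++_; [_]; length; map; foldr; downFrom; allFin; applyUpTo; tabulate)
open import Data.List.Membership.Propositional using (_∈_; _∉_)
open import Data.List.Membership.Propositional.Properties
open import Data.List.Properties
open import Data.List.Relation.Binary.Permutation.Propositional as Perm
  using (_↭_; ↭-refl; ↭-sym; ↭-trans)
import Data.List.Relation.Binary.Permutation.Propositional.Properties as Permₚ
import Data.List.Relation.Binary.Permutation.Setoid.Properties as Permₛₚ
open import Data.List.Relation.Ternary.Interleaving.Propositional using (Interleaving; []; consˡ; consʳ)
open import Data.List.Relation.Unary.All as All using (All; []; _∷_)
import Data.List.Relation.Unary.All.Properties as Allₚ
open import Data.List.Relation.Unary.AllPairs using ([]; _∷_)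
open import Data.List.Relation.Unary.Any using (here; there)
open import Data.List.Relation.Unary.Unique.Propositional using (Unique)
open import Data.List.Relation.Unary.Unique.Propositional.Properties using (downFrom⁺; allFin⁺)
open import Data.Nat
  using (ℕ; zero; suc; _+_; _*_; _∸_; _≤_; _<_; z≤n; s≤s; s≤s⁻¹; _≡ᵇ_; _<ᵇ_)
open import Data.Nat.DivMod
open import Data.Nat.Properties
open import Data.Nat.Tactic.RingSolver using (solve-∀)
open import Data.Product using (_×_; _,_; proj₁; proj₂; ∃)
open import Data.Rational as ℚ using (ℚ; 0ℚ; 1ℚ; ½)
import Data.Rational.Properties as ℚₚ
open import Data.Sum as Sum using (_⊎_; inj₁; inj₂)
open import Function using (_∘_; id)
open import Function.Bundles using (_⇔_; mk⇔; Equivalence; mk↔ₛ′)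
open import Relation.Binary.Definitions using (tri<; tri≈; tri>)
open import Relation.Binary.PropositionalEquality hiding ([_])
open import Relation.Nullary using (yes; no)
open import Relation.Nullary.Decidable using (toWitness)

-- Connectedness as the absence of cuts

-- The three coordinates are parity conditions on cuts. With the kept chords fixed, removing a set R
-- of cycle edges disconnects the graph exactly when R contains a nonempty cut avoiding those
-- chords. A set of cycle edges is such a cut exactly when it is even on the whole cycle (coordinate
-- 1) and on one arc of each kept chord (α and β). A removed chord imposes no condition, so its
-- coordinate becomes 0 and classes merge.
--
-- The count is the same polynomial for crossing, nested and disjoint chords, also when chord ends
-- coincide. Hence the optimisation runs before anything is known about the chords; the optimal
-- vector has no zero entry, and this is what rules out the non-crossing positions. With s and t the
-- sums of opposite classes, 16 times the polynomial is n² (n + 14) minus weighted squares; the 16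
-- clears two halvings. Unless 4 divides n, parity keeps some square from vanishing, so each residue
-- has its own least deficit. G is compared with a single competitor, the stated graph itself.

Constant : {V W : Set} → List (V × V) → (V → W) → Set
Constant N f = All (λ e → f (proj₁ e) ≡ f (proj₂ e)) N

-- `f` is the indicator of one side of a cut. Cuts in place of paths make connectedness a linear
-- statement over F₂.
Connected : {V : Set} → List (V × V) → Set
Connected {V} N = (f : V → Bool) → Constant N f → ∀ u v → f u ≡ f v

Connected-resp-↭ : {V : Set} {N M : List (V × V)} → N ↭ M → Connected N → Connected M
Connected-resp-↭ p c f k = c f (Permₚ.All-resp-↭ (Perm.↭-sym p) k)

all-intro : {A : Set} (P : A → Bool) (xs : List A) → (∀ x → x ∈ xs → P x ≡ true) → all P xs ≡ true
all-intro P []       h = refl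
all-intro P (x ∷ xs) h rewrite h x (here refl) = all-intro P xs (λ y m → h y (there m))

all-elim : {A : Set} (P : A → Bool) (xs : List A) → all P xs ≡ true → ∀ x → x ∈ xs → P x ≡ true
all-elim P (y ∷ xs) h x m with P y in eq
all-elim P (y ∷ xs) h x (here refl) | true = eq
all-elim P (y ∷ xs) h x (there m)   | true = all-elim P xs h x m
all-elim P (y ∷ xs) () x m          | false

any-intro : {A : Set} (P : A → Bool) {xs : List A} {x : A} → x ∈ xs → P x ≡ true → any P xs ≡ true
any-intro P             (here refl) h rewrite h = refl
any-intro P {y ∷ _} (there m)   h rewrite any-intro P m h = ∨-zeroʳ (P y)

any-elim : {A : Set} (P : A → Bool) (xs : List A) → any P xs ≡ true → ∃ λ x → x ∈ xs × P x ≡ true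
any-elim P (y ∷ xs) h with P y in eq
... | true  = y , here refl , eq
... | false with any-elim P xs h
...   | x , m , q = x , there m , q

≡ᵇ-refl : ∀ m → (m ≡ᵇ m) ≡ true
≡ᵇ-refl zero    = refl
≡ᵇ-refl (suc m) = ≡ᵇ-refl m

≡ᵇ-true⇒≡ : ∀ m n → (m ≡ᵇ n) ≡ true → m ≡ n
≡ᵇ-true⇒≡ m n h = ≡ᵇ⇒≡ m n (Equivalence.from T-≡ h)

≢⇒≡ᵇ-false : ∀ {m n} → m ≢ n → (m ≡ᵇ n) ≡ false
≢⇒≡ᵇ-false {m} {n} ne with m ≡ᵇ n in eq
... | true  = ⊥-elim (ne (≡ᵇ-true⇒≡ m n eq))
... | false = refl

true≢false : {b : Bool} → b ≡ true → b ≢ false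
true≢false refl ()

∨-elim : ∀ a {b} → a ∨ b ≡ true → a ≡ true ⊎ b ≡ true
∨-elim true  h = inj₁ refl
∨-elim false h = inj₂ h

∧-elim : ∀ a {b} → a ∧ b ≡ true → a ≡ true × b ≡ true
∧-elim true  h = refl , h

⇔⇒≡ : {a b : Bool} → (a ≡ true → b ≡ true) → (b ≡ true → a ≡ true) → a ≡ b
⇔⇒≡ {true}  {b}     f g = sym (f refl)
⇔⇒≡ {false} {true}  f g = g refl
⇔⇒≡ {false} {false} f g = refl

size : {A : Set} → (A → Bool) → List A → ℕ
size f []       = 0
size f (x ∷ xs) = (if f x then 1 else 0) + size f xs

size≤length : {A : Set} (f : A → Bool) (xs : List A) → size f xs ≤ length xs
size≤length f []       = z≤n
size≤length f (x ∷ xs) with f x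
... | true  = s≤s (size≤length f xs)
... | false = m≤n⇒m≤1+n (size≤length f xs)

size-mono : {A : Set} (f g : A → Bool) (xs : List A) → (∀ x → f x ≡ true → g x ≡ true) →
            size f xs ≤ size g xs
size-mono f g []       h = z≤n
size-mono f g (x ∷ xs) h with f x in eq
... | true rewrite h x eq = s≤s (size-mono f g xs h)
... | false = ≤-trans (size-mono f g xs h) (m≤n+m _ _)

size-strict : {A : Set} (f g : A → Bool) (xs : List A) → (∀ x → f x ≡ true → g x ≡ true) →
              ∀ {y} → y ∈ xs → f y ≡ false → g y ≡ true → size f xs < size g xs
size-strict f g (x ∷ xs) h (here refl) p q rewrite p | q = s≤s (size-mono f g xs h)
size-strict f g (x ∷ xs) h (there m) p q with f x in eq
... | true rewrite h x eq = s≤s (size-strict f g xs h m p q)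
... | false = ≤-trans (size-strict f g xs h m p q) (m≤n+m _ _)

module _ {m : ℕ} (N : List (Fin (suc m) × Fin (suc m))) where

  step : ℕ → Fin (suc m) → Fin (suc m) × Fin (suc m) → Bool
  step k v e = (reach N k (proj₁ e) ∧ (proj₂ e == v)) ∨ (reach N k (proj₂ e) ∧ (proj₁ e == v))

  ==⇒≡ : ∀ {u v : Fin (suc m)} → (u == v) ≡ true → u ≡ v
  ==⇒≡ h = Finₚ.toℕ-injective (≡ᵇ-true⇒≡ _ _ h)

  step⇒ : ∀ k v e → step k v e ≡ true →
          (reach N k (proj₁ e) ≡ true × proj₂ e ≡ v) ⊎ (reach N k (proj₂ e) ≡ true × proj₁ e ≡ v)
  step⇒ k v e h with ∨-elim (reach N k (proj₁ e) ∧ (proj₂ e == v)) h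
  ... | inj₁ p = let q , r = ∧-elim (reach N k (proj₁ e)) p in inj₁ (q , ==⇒≡ r)
  ... | inj₂ p = let q , r = ∧-elim (reach N k (proj₂ e)) p in inj₂ (q , ==⇒≡ r)

  reach-sound : (f : Fin (suc m) → Bool) → Constant N f → ∀ k v → reach N k v ≡ true → f v ≡ f Fin.zero
  reach-sound f c zero    v h = cong f (==⇒≡ h)
  reach-sound f c (suc k) v h with ∨-elim (reach N k v) h
  ... | inj₁ p = reach-sound f c k v p
  ... | inj₂ p with any-elim (step k v) N p
  ...   | e , e∈N , q with step⇒ k v e q
  ...     | inj₁ (r , refl) = trans (sym (All.lookup c e∈N)) (reach-sound f c k _ r)
  ...     | inj₂ (r , refl) = trans (All.lookup c e∈N) (reach-sound f c k _ r)

  reach-suc : ∀ k v → reach N k v ≡ true → reach N (suc k) v ≡ true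
  reach-suc k v h rewrite h = refl

  reach-edge : ∀ k {e} → e ∈ N → reach N k (proj₁ e) ≡ true → reach N (suc k) (proj₂ e) ≡ true
  reach-edge k {e} m h =
    trans (cong (reach N k (proj₂ e) ∨_) (any-intro (step k (proj₂ e)) m s)) (∨-zeroʳ _)
    where s : step k (proj₂ e) e ≡ true
          s rewrite h | ≡ᵇ-refl (toℕ (proj₂ e)) = refl

  reach-edge⁻ : ∀ k {e} → e ∈ N → reach N k (proj₂ e) ≡ true → reach N (suc k) (proj₁ e) ≡ true
  reach-edge⁻ k {e} m h =
    trans (cong (reach N k (proj₁ e) ∨_) (any-intro (step k (proj₁ e)) m s)) (∨-zeroʳ _)
    where s : step k (proj₁ e) e ≡ true
          s rewrite h | ≡ᵇ-refl (toℕ (proj₁ e)) = ∨-zeroʳ _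

  constant? : (f : Fin (suc m) → Bool) (M : List (Fin (suc m) × Fin (suc m))) →
              Constant M f ⊎ ∃ λ e → e ∈ M × f (proj₁ e) ≢ f (proj₂ e)
  constant? f [] = inj₁ []
  constant? f (e ∷ M) with f (proj₁ e) Boolₚ.≟ f (proj₂ e) | constant? f M
  ... | no ne | _                    = inj₂ (e , here refl , ne)
  ... | yes _ | inj₂ (e′ , e∈M , ne) = inj₂ (e′ , there e∈M , ne)
  ... | yes p | inj₁ c               = inj₁ (p ∷ c)

  reach-constant : ∀ k → Constant N (reach N k) → ∀ v → reach N (suc k) v ≡ reach N k v
  reach-constant k c v = ⇔⇒≡ to (reach-suc k v)
    where
    to : reach N (suc k) v ≡ true → reach N k v ≡ true
    to h with ∨-elim (reach N k v) h
    ... | inj₁ p = p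
    ... | inj₂ p with any-elim (step k v) N p
    ...   | e , e∈N , q with step⇒ k v e q
    ...     | inj₁ (r , refl) = trans (sym (All.lookup c e∈N)) r
    ...     | inj₂ (r , refl) = trans (All.lookup c e∈N) r

  -- The reached sets grow strictly until they stabilise.
  reach-grows : ∀ k → Constant N (reach N k) ⊎ suc k ≤ size (reach N k) (allFin (suc m))
  reach-grows zero = inj₂ (s≤s z≤n)
  reach-grows (suc k) with reach-grows k
  ... | inj₁ c = inj₁ (All.map (λ {e} p →
          trans (reach-constant k c (proj₁ e)) (trans p (sym (reach-constant k c (proj₂ e))))) c)
  ... | inj₂ b with constant? (reach N k) N
  ...   | inj₁ c = inj₁ (All.map (λ {e} p →
            trans (reach-constant k c (proj₁ e)) (trans p (sym (reach-constant k c (proj₂ e))))) c)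
  ...   | inj₂ ((u , v) , e∈N , ne) with reach N k u in p | reach N k v in q
  ...     | true  | true  = ⊥-elim (ne refl)
  ...     | false | false = ⊥-elim (ne refl)
  ...     | true  | false = inj₂ (≤-trans (s≤s b)
              (size-strict (reach N k) _ _ (reach-suc k) (∈-allFin v) q (reach-edge k e∈N p)))
  ...     | false | true  = inj₂ (≤-trans (s≤s b)
              (size-strict (reach N k) _ _ (reach-suc k) (∈-allFin u) p (reach-edge⁻ k e∈N q)))

  -- Otherwise `reach-grows` would put m + 2 of the m + 1 vertices into the reached set.
  reach-stable : Constant N (reach N (suc m))
  reach-stable with reach-grows (suc m)
  ... | inj₁ c = c
  ... | inj₂ b = ⊥-elim (<-irrefl refl (≤-trans b (≤-trans (size≤length (reach N (suc m)) (allFin (suc m)))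
                   (≤-reflexive (length-tabulate {n = suc m} id)))))

  reach-zero : ∀ k → reach N k Fin.zero ≡ true
  reach-zero zero    = refl
  reach-zero (suc k) = reach-suc k Fin.zero (reach-zero k)

  connected?⇒Connected : connected? (suc m) N ≡ true → Connected N
  connected?⇒Connected h f c u v = trans (f≡ u) (sym (f≡ v))
    where f≡ : ∀ w → f w ≡ f Fin.zero
          f≡ w = reach-sound f c (suc m) w (all-elim (reach N (suc m)) (allFin (suc m)) h w (∈-allFin w))

  -- The reached set itself is the cut to be tested: by `reach-stable` no edge leaves it.
  Connected⇒connected? : Connected N → connected? (suc m) N ≡ true
  Connected⇒connected? c = all-intro (reach N (suc m)) (allFin (suc m))
    (λ v _ → trans (c (reach N (suc m)) reach-stable v Fin.zero) (reach-zero (suc m)))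

connected?-resp-↭ : ∀ {m} {N M : List (Fin (suc m) × Fin (suc m))} → N ↭ M →
                    connected? (suc m) N ≡ connected? (suc m) M
connected?-resp-↭ {N = N} {M} p = ⇔⇒≡
  (λ h → Connected⇒connected? M (Connected-resp-↭ p (connected?⇒Connected N h)))
  (λ h → Connected⇒connected? N (Connected-resp-↭ (Perm.↭-sym p) (connected?⇒Connected M h)))

-- Counting connected subgraphs

cnt : {A : Set} → (List A → Bool) → List A → ℕ
cnt P []       = if P [] then 1 else 0
cnt P (x ∷ xs) = cnt P xs + cnt (λ N → P (x ∷ N)) xs

cnt-cong : {A : Set} {P Q : List A → Bool} (xs : List A) → (∀ N → P N ≡ Q N) → cnt P xs ≡ cnt Q xs
cnt-cong []       h rewrite h [] = refl
cnt-cong (x ∷ xs) h = cong₂ _+_ (cnt-cong xs h) (cnt-cong xs (λ N → h (x ∷ N)))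

cnt-false : {A : Set} (xs : List A) → cnt (λ _ → false) xs ≡ 0
cnt-false []       = refl
cnt-false (x ∷ xs) = cong₂ _+_ (cnt-false xs) (cnt-false xs)

cnt-map : {A B : Set} (P : List B → Bool) (g : A → B) (xs : List A) →
          cnt P (map g xs) ≡ cnt (P ∘ map g) xs
cnt-map P g []       = refl
cnt-map P g (x ∷ xs) = cong₂ _+_ (cnt-map P g xs) (cnt-map (P ∘ (g x ∷_)) g xs)

cnt-↭ : {A : Set} {P : List A → Bool} {xs ys : List A} → (∀ {N M} → N ↭ M → P N ≡ P M) →
        xs ↭ ys → cnt P xs ≡ cnt P ys
cnt-↭ h Perm.refl       = refl
cnt-↭ h (Perm.prep x p)  = cong₂ _+_ (cnt-↭ h p) (cnt-↭ (λ q → h (Perm.prep x q)) p)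
cnt-↭ h (Perm.trans p q) = trans (cnt-↭ h p) (cnt-↭ h q)
cnt-↭ {P = P} {_ ∷ _ ∷ xs} {_ ∷ _ ∷ ys} h (Perm.swap x y p) = begin
  (cnt P xs + cnt P-y xs) + (cnt P-x xs + cnt P-xy xs)
    ≡⟨ +-assoc (cnt P xs) _ _ ⟩
  cnt P xs + (cnt P-y xs + (cnt P-x xs + cnt P-xy xs))
    ≡⟨ cong (cnt P xs +_) (trans (sym (+-assoc (cnt P-y xs) _ _))
         (trans (cong (_+ cnt P-xy xs) (+-comm (cnt P-y xs) (cnt P-x xs))) (+-assoc (cnt P-x xs) _ _))) ⟩
  cnt P xs + (cnt P-x xs + (cnt P-y xs + cnt P-xy xs))
    ≡⟨ sym (+-assoc (cnt P xs) _ _) ⟩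
  (cnt P xs + cnt P-x xs) + (cnt P-y xs + cnt P-xy xs)
    ≡⟨ cong₂ _+_ (cong₂ _+_ (cnt-↭ h p) (cnt-↭ (h ∘ Perm.prep x) p))
         (cong₂ _+_ (cnt-↭ (h ∘ Perm.prep y) p)
           (trans (cnt-cong xs (λ N → h (Perm.swap x y Perm.refl)))
                  (cnt-↭ (h ∘ Perm.prep y ∘ Perm.prep x) p))) ⟩
  (cnt P ys + cnt P-x ys) + (cnt P-y ys + cnt (λ N → P (y ∷ x ∷ N)) ys) ∎
  where open ≡-Reasoning
        P-x  = λ N → P (x ∷ N)
        P-y  = λ N → P (y ∷ N)
        P-xy = λ N → P (x ∷ y ∷ N)

-- Choosing N amounts to choosing the complementary R. Each head goes to opposite sides, so the two
-- branches of the count change places.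
cnt-complement : {A : Set} {P Q : List A → Bool} (xs : List A) →
                 (∀ {N R} → Interleaving N R xs → P N ≡ Q R) → cnt P xs ≡ cnt Q xs
cnt-complement []       h rewrite h [] = refl
cnt-complement {P = P} (x ∷ xs) h =
  trans (+-comm (cnt P xs) _)
        (cong₂ _+_ (cnt-complement xs (λ i → h (consˡ i))) (cnt-complement xs (λ i → h (consʳ i))))

^-+ : ∀ p i j → (p ^ i) ℚ.* (p ^ j) ≡ p ^ (i + j)
^-+ p zero    j = ℚₚ.*-identityˡ _
^-+ p (suc i) j = trans (ℚₚ.*-assoc p _ _) (cong (p ℚ.*_) (^-+ p i j))

½^-pos : ∀ m → 0ℚ ℚ.< ½ ^ m
½^-pos zero    = toWitness {a? = 0ℚ ℚ.<? 1ℚ} _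
½^-pos (suc m) = ℚₚ.<-respˡ-≡ (ℚₚ.*-zeroʳ ½) (ℚₚ.*-monoʳ-<-pos ½ (½^-pos m))

_×ℚ_ : ℕ → ℚ → ℚ
zero  ×ℚ q = 0ℚ
suc c ×ℚ q = q ℚ.+ (c ×ℚ q)

×ℚ-+ : ∀ c d q → ((c + d) ×ℚ q) ≡ (c ×ℚ q) ℚ.+ (d ×ℚ q)
×ℚ-+ zero    d q = sym (ℚₚ.+-identityˡ _)
×ℚ-+ (suc c) d q = trans (cong (q ℚ.+_) (×ℚ-+ c d q)) (sym (ℚₚ.+-assoc q _ _))

×ℚ-nonneg : ∀ c q → 0ℚ ℚ.< q → 0ℚ ℚ.≤ (c ×ℚ q)
×ℚ-nonneg zero    q h = ℚₚ.≤-refl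
×ℚ-nonneg (suc c) q h =
  subst (ℚ._≤ (suc c ×ℚ q)) (ℚₚ.+-identityˡ 0ℚ) (ℚₚ.+-mono-≤ (ℚₚ.<⇒≤ h) (×ℚ-nonneg c q h))

×ℚ-cancel-≤ : ∀ c d q → 0ℚ ℚ.< q → (c ×ℚ q) ℚ.≤ (d ×ℚ q) → c ≤ d
×ℚ-cancel-≤ zero    d       q h le = z≤n
×ℚ-cancel-≤ (suc c) zero    q h le = ⊥-elim (ℚₚ.<-irrefl refl (ℚₚ.<-≤-trans
  (ℚₚ.<-respˡ-≡ (ℚₚ.+-identityˡ 0ℚ) (ℚₚ.+-mono-<-≤ h (×ℚ-nonneg c q h))) le))
×ℚ-cancel-≤ (suc c) (suc d) q h le = s≤s (×ℚ-cancel-≤ c d q h (ℚₚ.≮⇒≥ λ lt →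
  ℚₚ.<-irrefl refl (ℚₚ.<-≤-trans (ℚₚ.+-mono-≤-< (ℚₚ.≤-refl {q}) lt) le)))

sumℚ : List ℚ → ℚ
sumℚ = foldr ℚ._+_ 0ℚ

sumℚ-++ : ∀ xs ys → sumℚ (xs ++ ys) ≡ sumℚ xs ℚ.+ sumℚ ys
sumℚ-++ []       ys = sym (ℚₚ.+-identityˡ _)
sumℚ-++ (x ∷ xs) ys = trans (cong (x ℚ.+_) (sumℚ-++ xs ys)) (sym (ℚₚ.+-assoc x _ _))

subsets-length : {A : Set} (xs : List A) → All (λ N → length N ≤ length xs) (subsets xs)
subsets-length []       = z≤n ∷ []
subsets-length (x ∷ xs) =
  Allₚ.++⁺ (All.map m≤n⇒m≤1+n (subsets-length xs)) (Allₚ.map⁺ (All.map s≤s (subsets-length xs)))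

sum-subsets : {A : Set} (P : List A → Bool) (q : ℚ) (xs : List A) →
              sumℚ (map (λ N → if P N then q else 0ℚ) (subsets xs)) ≡ cnt P xs ×ℚ q
sum-subsets P q [] with P []
... | true  = refl
... | false = refl
sum-subsets P q (x ∷ xs) = begin
  sumℚ (map g (subsets xs ++ map (x ∷_) (subsets xs)))
    ≡⟨ cong sumℚ (map-++ g (subsets xs) _) ⟩
  sumℚ (map g (subsets xs) ++ map g (map (x ∷_) (subsets xs)))
    ≡⟨ sumℚ-++ (map g (subsets xs)) _ ⟩
  sumℚ (map g (subsets xs)) ℚ.+ sumℚ (map g (map (x ∷_) (subsets xs)))
    ≡⟨ cong₂ ℚ._+_ (sum-subsets P q xs)
         (trans (cong sumℚ (sym (map-∘ (subsets xs)))) (sum-subsets (P ∘ (x ∷_)) q xs)) ⟩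
  (cnt P xs ×ℚ q) ℚ.+ (cnt (P ∘ (x ∷_)) xs ×ℚ q)
    ≡⟨ sym (×ℚ-+ (cnt P xs) _ q) ⟩
  cnt P (x ∷ xs) ×ℚ q ∎
  where open ≡-Reasoning
        g = λ N → if P N then q else 0ℚ

map-cong-All : {A B : Set} {f g : A → B} {xs : List A} → All (λ x → f x ≡ g x) xs → map f xs ≡ map g xs
map-cong-All []       = refl
map-cong-All (p ∷ ps) = cong₂ _∷_ p (map-cong-All ps)

Rel-½ : ∀ {n} (G : Graph n) → Rel G ½ ≡ cnt (connected? n) (edges G) ×ℚ (½ ^ ∣E∣ G)
Rel-½ {n} G = trans (cong sumℚ (map-cong-All (All.map weight (subsets-length (edges G)))))
                    (sum-subsets (connected? n) _ (edges G))
  where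
  weight : ∀ {N} → length N ≤ ∣E∣ G →
           (if connected? n N then (½ ^ length N) ℚ.* ((1ℚ ℚ.- ½) ^ (∣E∣ G ∸ length N)) else 0ℚ)
           ≡ (if connected? n N then ½ ^ ∣E∣ G else 0ℚ)
  weight {N} le with connected? n N
  -- Since `1ℚ - ½` evaluates to `½`, the two powers merge; the length bound keeps `∸` from
  -- truncating.
  ... | true  = trans (^-+ ½ (length N) _) (cong (½ ^_) (m+[n∸m]≡n le))
  ... | false = refl

reliable⇒cnt-max : ∀ {n m} {G : Graph n} → UniformlyMostReliable m G →
                   (H : Graph n) → Hamiltonian H → ∣E∣ H ≡ m →
                   cnt (connected? n) (edges H) ≤ cnt (connected? n) (edges G)
reliable⇒cnt-max {n} {m} {G} ((_ , refl) , best) H ham eq =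
  ×ℚ-cancel-≤ _ _ (½ ^ m) (½^-pos m) (subst₂ ℚ._≤_
    (trans (Rel-½ H) (cong (λ e → cnt (connected? n) (edges H) ×ℚ (½ ^ e)) eq)) (Rel-½ G)
    (best H ham eq ½ (toWitness {a? = 0ℚ ℚ.≤? ½} _) (toWitness {a? = ½ ℚ.≤? 1ℚ} _)))

-- Independent families of colours

Colour : Set
Colour = Bool × Bool

pattern c₀₀ = false , false
pattern c₀₁ = false , true
pattern c₁₀ = true  , false
pattern c₁₁ = true  , true

_≐_ : Colour → Colour → Bool
(a , b) ≐ (c , d) = not (a xor c) ∧ not (b xor d)

≐-refl : ∀ c → (c ≐ c) ≡ true
≐-refl c₀₀ = refl
≐-refl c₀₁ = refl
≐-refl c₁₀ = refl
≐-refl c₁₁ = refl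

≐⇒≡ : ∀ c d → (c ≐ d) ≡ true → c ≡ d
≐⇒≡ c₀₀ c₀₀ _ = refl
≐⇒≡ c₀₁ c₀₁ _ = refl
≐⇒≡ c₁₀ c₁₀ _ = refl
≐⇒≡ c₁₁ c₁₁ _ = refl

_∖_ : (Colour → Bool) → Colour → Colour → Bool
(S ∖ c) d = S d ∧ not (d ≐ c)

-- S is the set of colours not used so far.  The four vectors (1,α,β) of F₂³ have
-- (1,1,1,1) as their only linear relation, so a family of them is linearly independent
-- exactly when its colours are distinct and not all four occur.
independent : (Colour → Bool) → List Colour → Bool
independent S []       = S c₀₀ ∨ S c₀₁ ∨ S c₁₀ ∨ S c₁₁
independent S (c ∷ cs) = S c ∧ independent (S ∖ c) cs

full : Colour → Bool
full _ = true

occ : Colour → List Colour → ℕ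
occ c []       = 0
occ c (d ∷ ds) = (if c ≐ d then 1 else 0) + occ c ds

weight : ℕ → (Colour → Bool) → List Colour → Colour → ℕ
weight e S cs c = if S c then e + occ c cs else 1

Π₄ : (Colour → ℕ) → ℕ
Π₄ g = g c₀₀ * g c₀₁ * g c₁₀ * g c₁₁

private
  arith₁ : ∀ e x p q r → (e + suc x) * p * q * r ≡ (e + x) * p * q * r + 1 * p * q * r
  arith₁ = solve-∀
  arith₂ : ∀ e x p q r → p * (e + suc x) * q * r ≡ p * (e + x) * q * r + p * 1 * q * r
  arith₂ = solve-∀
  arith₃ : ∀ e x p q r → p * q * (e + suc x) * r ≡ p * q * (e + x) * r + p * q * 1 * r
  arith₃ = solve-∀
  arith₄ : ∀ e x p q r → p * q * r * (e + suc x) ≡ p * q * r * (e + x) + p * q * r * 1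
  arith₄ = solve-∀
  arith₅ : ∀ a b {p q P Q} → a + p ≡ P → b + q ≡ Q → (a + b) + (p + q) ≡ P + Q
  arith₅ a b {p} {q} refl refl = lemma a b p q
    where lemma : ∀ a b p q → (a + b) + (p + q) ≡ (a + p) + (b + q)
          lemma = solve-∀

-- The product is affine in the size of the class of c; its slope is the product with that factor
-- replaced by 1, that is, with c marked as used.
weight-∷ : ∀ e S c cs → S c ≡ true →
           Π₄ (weight e S (c ∷ cs)) ≡ Π₄ (weight e S cs) + Π₄ (weight e (S ∖ c) cs)
weight-∷ e S c₀₀ cs h rewrite h | ∧-identityʳ (S c₀₁) | ∧-identityʳ (S c₁₀) | ∧-identityʳ (S c₁₁) =
  arith₁ e (occ c₀₀ cs) _ _ _
weight-∷ e S c₀₁ cs h rewrite h | ∧-identityʳ (S c₀₀) | ∧-identityʳ (S c₁₀) | ∧-identityʳ (S c₁₁) =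
  arith₂ e (occ c₀₁ cs) (weight e S cs c₀₀) _ _
weight-∷ e S c₁₀ cs h rewrite h | ∧-identityʳ (S c₀₁) | ∧-identityʳ (S c₀₀) | ∧-identityʳ (S c₁₁) =
  arith₃ e (occ c₁₀ cs) (weight e S cs c₀₀) (weight e S cs c₀₁) _
weight-∷ e S c₁₁ cs h rewrite h | ∧-identityʳ (S c₀₁) | ∧-identityʳ (S c₁₀) | ∧-identityʳ (S c₀₀) =
  arith₄ e (occ c₁₁ cs) (weight e S cs c₀₀) (weight e S cs c₀₁) (weight e S cs c₁₀)

weight-∷-used : ∀ e S c cs → S c ≡ false → Π₄ (weight e S (c ∷ cs)) ≡ Π₄ (weight e S cs)
weight-∷-used e S c₀₀ cs h rewrite h = refl
weight-∷-used e S c₀₁ cs h rewrite h = refl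
weight-∷-used e S c₁₀ cs h rewrite h = refl
weight-∷-used e S c₁₁ cs h rewrite h = refl

cnt-independent : ∀ S cs → cnt (independent S) cs + Π₄ (weight 0 S cs) ≡ Π₄ (weight 1 S cs)
cnt-independent S [] with S c₀₀ | S c₀₁ | S c₁₀ | S c₁₁
... | true  | true  | true  | true  = refl
... | true  | true  | true  | false = refl
... | true  | true  | false | true  = refl
... | true  | true  | false | false = refl
... | true  | false | true  | true  = refl
... | true  | false | true  | false = refl
... | true  | false | false | true  = refl
... | true  | false | false | false = refl
... | false | true  | true  | true  = refl
... | false | true  | true  | false = refl
... | false | true  | false | true  = refl
... | false | true  | false | false = refl
... | false | false | true  | true  = refl
... | false | false | true  | false = refl
... | false | false | false | true  = refl
... | false | false | false | false = refl
cnt-independent S (c ∷ cs) with S c in eq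
... | true  = trans (cong (cnt (independent S) cs + cnt (independent (S ∖ c)) cs +_) (weight-∷ 0 S c cs eq))
  (trans (arith₅ (cnt (independent S) cs) (cnt (independent (S ∖ c)) cs) (cnt-independent S cs) (cnt-independent (S ∖ c) cs)) (sym (weight-∷ 1 S c cs eq)))
... | false = trans (cong₂ _+_ (trans (cong (cnt (independent S) cs +_) (cnt-false cs)) (+-identityʳ _))
                               (weight-∷-used 0 S c cs eq))
  (trans (cnt-independent S cs) (sym (weight-∷-used 1 S c cs eq)))

-- Linear dependencies over F₂

xsum : {A : Set} → (A → Bool) → List A → Bool
xsum g []       = false
xsum g (i ∷ is) = g i xor xsum g is

xsum-cong : {A : Set} {g h : A → Bool} (L : List A) → (∀ i → i ∈ L → g i ≡ h i) → xsum g L ≡ xsum h L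
xsum-cong []      e = refl
xsum-cong (i ∷ L) e = cong₂ _xor_ (e i (here refl)) (xsum-cong L (λ j m → e j (there m)))

xsum-false : {A : Set} {g : A → Bool} (L : List A) → (∀ i → i ∈ L → g i ≡ false) → xsum g L ≡ false
xsum-false []      e = refl
xsum-false (i ∷ L) e rewrite e i (here refl) = xsum-false L (λ j m → e j (there m))

module Parity (col : ℕ → Colour) where

  parity : (ℕ → Bool) → List ℕ → Colour → Bool
  parity x R c = xsum (λ i → (c ≐ col i) ∧ x i) R

  -- Class sums that all agree form a multiple of (1,1,1,1); so this says that the corresponding
  -- combination of the vectors (1,α,β) is zero.
  Balanced : (Colour → Bool) → Set
  Balanced y = ∀ c d → y c ≡ y d

  -- y carries the contribution of the colours outside S.
  independent⇒trivial : ∀ S R (x : ℕ → Bool) (y : Colour → Bool) → independent S (map col R) ≡ true →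
    (∀ c → S c ≡ true → y c ≡ false) → Balanced (λ c → y c xor parity x R c) →
    (∀ c → y c ≡ false) × All (λ i → x i ≡ false) R
  independent⇒trivial S [] x y h z bal = (λ c → trans (y≡ c (proj₁ w)) (z _ (proj₂ w))) , []
    where
    w : ∃ λ c → S c ≡ true
    w with ∨-elim (S c₀₀) h
    ... | inj₁ p = _ , p
    ... | inj₂ q with ∨-elim (S c₀₁) q
    ...   | inj₁ p = _ , p
    ...   | inj₂ r with ∨-elim (S c₁₀) r
    ...     | inj₁ p = _ , p
    ...     | inj₂ p = _ , p
    y≡ : ∀ c d → y c ≡ y d
    y≡ c d = trans (sym (xor-identityʳ _)) (trans (bal c d) (xor-identityʳ _))
  independent⇒trivial S (i ∷ R) x y h z bal with ∧-elim (S (col i)) h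
  ... | p , q = y≡0 , (x≡0 ∷ proj₂ ih)
    where
    y′ : Colour → Bool
    -- The term of i moves from the sum into the carried part.
    y′ c = y c xor ((c ≐ col i) ∧ x i)
    z′ : ∀ c → (S ∖ col i) c ≡ true → y′ c ≡ false
    z′ c s with ∧-elim (S c) s
    ... | s₁ , s₂ with c ≐ col i
    ...   | false = trans (xor-identityʳ _) (z c s₁)
    ih = independent⇒trivial (S ∖ col i) R x y′ q z′ (λ c d →
           trans (xor-assoc (y c) _ _) (trans (bal c d) (sym (xor-assoc (y d) _ _))))
    x≡0 : x i ≡ false
    x≡0 = subst (λ b → (b ∧ x i) ≡ false) (≐-refl (col i))
            (subst (λ b → (b xor ((col i ≐ col i) ∧ x i)) ≡ false) (z _ p) (proj₁ ih (col i)))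
    y≡0 : ∀ c → y c ≡ false
    y≡0 c = trans (sym (xor-identityʳ _)) (trans (cong (y c xor_) (sym (trans (cong ((c ≐ col i) ∧_) x≡0)
              (∧-zeroʳ _)))) (proj₁ ih c))

  -- The data that would contradict `independent⇒trivial`: coefficients `x` on R and a carry `y` on
  -- the used colours, not all zero. `x` is defined on all positions so that it can be summed along
  -- the whole cycle.
  record Dependency (S : Colour → Bool) (R : List ℕ) : Set where
    field
      x        : ℕ → Bool
      y        : Colour → Bool
      outside  : ∀ c → S c ≡ true → y c ≡ false
      support  : ∀ i → i ∉ R → x i ≡ false
      balanced : Balanced (λ c → y c xor parity x R c)
      nonzero  : (∃ λ c → y c ≡ true) ⊎ (∃ λ i → i ∈ R × x i ≡ true)

  dependent⇒Dependency : ∀ S R → Unique R → independent S (map col R) ≡ false → Dependency S R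
  dependent⇒Dependency S [] u h = record
    { x = λ _ → false ; y = λ _ → true
    ; outside  = λ c s → ⊥-elim (true≢false s (none c))
    ; support  = λ _ _ → refl
    ; balanced = λ _ _ → refl
    ; nonzero  = inj₁ (c₀₀ , refl) }
    where
    ∨-false : ∀ a {b} → a ∨ b ≡ false → a ≡ false × b ≡ false
    ∨-false false e = refl , e
    none : ∀ c → S c ≡ false
    none c with ∨-false (S c₀₀) h
    ... | p , h₁ with ∨-false (S c₀₁) h₁
    ...   | q , h₂ with ∨-false (S c₁₀) h₂
    none c₀₀ | p , h₁ | q , h₂ | r , s = p
    none c₀₁ | p , h₁ | q , h₂ | r , s = q
    none c₁₀ | p , h₁ | q , h₂ | r , s = r
    none c₁₁ | p , h₁ | q , h₂ | r , s = s
  dependent⇒Dependency S (i ∷ R) (i∉R ∷ u) h with S (col i) in eq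
  ... | false = record
    { x = i ≡ᵇ_ ; y = _≐ col i
    ; outside  = out
    ; support  = λ j j∉ → ≢⇒≡ᵇ-false (λ p → j∉ (here (sym p)))
    ; balanced = λ c d → trans (zero-sum c) (sym (zero-sum d))
    ; nonzero  = inj₂ (i , here refl , ≡ᵇ-refl i) }
    where
    out : ∀ c → S c ≡ true → (c ≐ col i) ≡ false
    out c s with c ≐ col i in e
    ... | false = refl
    ... | true rewrite ≐⇒≡ c (col i) e = ⊥-elim (true≢false s eq)
    zero-sum : ∀ c → (c ≐ col i) xor parity (i ≡ᵇ_) (i ∷ R) c ≡ false
    zero-sum c rewrite ≡ᵇ-refl i | ∧-identityʳ (c ≐ col i)
      | xsum-false {g = λ j → (c ≐ col j) ∧ (i ≡ᵇ j)} R (λ j m →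
          trans (cong ((c ≐ col j) ∧_) (≢⇒≡ᵇ-false (All.lookup i∉R m))) (∧-zeroʳ _))
      | xor-identityʳ (c ≐ col i) = xor-same (c ≐ col i)
  ... | true with dependent⇒Dependency (S ∖ col i) R u h
  ...   | record { x = x′ ; y = y′ ; outside = out′ ; support = sup′ ; balanced = bal′ ; nonzero = nz′ } = record
    { x = x″ ; y = y″
    ; outside  = out
    ; support  = sup
    ; balanced = λ c d → trans (shift c) (trans (bal′ c d) (sym (shift d)))
    ; nonzero  = nz nz′ }
    where
    x″ : ℕ → Bool
    x″ j = if i ≡ᵇ j then y′ (col i) else x′ j
    y″ : Colour → Bool
    y″ c = y′ c ∧ not (c ≐ col i)
    x″i : x″ i ≡ y′ (col i)
    x″i rewrite ≡ᵇ-refl i = refl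
    x″j : ∀ {j} → i ≢ j → x″ j ≡ x′ j
    x″j ne rewrite ≢⇒≡ᵇ-false ne = refl
    out : ∀ c → S c ≡ true → y″ c ≡ false
    out c s with c ≐ col i in e
    ... | true  = ∧-zeroʳ _
    ... | false = trans (∧-identityʳ _) (out′ c (trans (cong₂ (λ a b → a ∧ not b) s e) refl))
    sup : ∀ j → j ∉ (i ∷ R) → x″ j ≡ false
    sup j j∉ = trans (x″j (λ p → j∉ (here (sym p)))) (sup′ j (j∉ ∘ there))
    shift : ∀ c → y″ c xor parity x″ (i ∷ R) c ≡ y′ c xor parity x′ R c
    shift c = trans (cong (y″ c xor_) (cong₂ _xor_ (cong ((c ≐ col i) ∧_) x″i)
                (xsum-cong R (λ j m → cong ((c ≐ col j) ∧_) (x″j (All.lookup i∉R m))))))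
              (trans (sym (xor-assoc (y″ c) _ _)) (cong (_xor parity x′ R c) head-y))
      where
      head-y : y″ c xor ((c ≐ col i) ∧ y′ (col i)) ≡ y′ c
      head-y with c ≐ col i in e
      ... | false = trans (xor-identityʳ _) (∧-identityʳ _)
      ... | true rewrite ≐⇒≡ c (col i) e = cong (_xor y′ (col i)) (∧-zeroʳ (y′ (col i)))
    nz : (∃ λ c → y′ c ≡ true) ⊎ (∃ λ j → j ∈ R × x′ j ≡ true) →
         (∃ λ c → y″ c ≡ true) ⊎ (∃ λ j → j ∈ (i ∷ R) × x″ j ≡ true)
    nz (inj₂ (j , m , t)) = inj₂ (j , there m , trans (x″j (All.lookup i∉R m)) t)
    nz (inj₁ (c , t)) with c ≐ col i in e
    ... | false = inj₁ (c , cong₂ (λ a b → a ∧ not b) t e)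
    ... | true  = inj₂ (i , here refl , trans x″i (trans (cong y′ (sym (≐⇒≡ c (col i) e))) t))

-- Cycles with two chords

∈-left : {A : Set} {N R L : List A} {i : A} → Interleaving N R L → i ∈ N → i ∈ L
∈-left (consˡ t) (here p)  = here p
∈-left (consˡ t) (there m) = there (∈-left t m)
∈-left (consʳ t) m         = there (∈-left t m)

∈-right : {A : Set} {N R L : List A} {i : A} → Interleaving N R L → i ∈ R → i ∈ L
∈-right (consʳ t) (here p)  = here p
∈-right (consʳ t) (there m) = there (∈-right t m)
∈-right (consˡ t) m         = there (∈-right t m)

∈-split : {A : Set} {N R L : List A} {i : A} → Interleaving N R L → i ∈ L → i ∈ N ⊎ i ∈ R
∈-split (consˡ t) (here p) = inj₁ (here p)
∈-split (consʳ t) (here p) = inj₂ (here p)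
∈-split (consˡ t) (there m) with ∈-split t m
... | inj₁ a = inj₁ (there a)
... | inj₂ b = inj₂ b
∈-split (consʳ t) (there m) with ∈-split t m
... | inj₁ a = inj₁ a
... | inj₂ b = inj₂ (there b)

Unique-right : {A : Set} {N R L : List A} → Interleaving N R L → Unique L → Unique R
Unique-right []        u       = u
Unique-right (consˡ t) (_ ∷ u) = Unique-right t u
Unique-right (consʳ t) (h ∷ u) =
  All.tabulate (λ m → All.lookup h (∈-right t m)) ∷ Unique-right t u

left∉right : {A : Set} {N R L : List A} {i : A} → Interleaving N R L → Unique L → i ∈ N → i ∉ R
left∉right (consˡ t) (h ∷ u) (here refl) m = All.lookup h (∈-right t m) refl
left∉right (consˡ t) (h ∷ u) (there k)   m = left∉right t u k m
left∉right (consʳ t) (h ∷ u) k (here refl) = All.lookup h (∈-left t k) refl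
left∉right (consʳ t) (h ∷ u) k (there m)   = left∉right t u k m

open CommutativeSemigroupₚ (CommutativeRing.+-commutativeSemigroup Boolₚ.xor-∧-commutativeRing) using (interchange)

xor-≡ : ∀ {p q} → p xor q ≡ false → p ≡ q
xor-≡ {true}  {true}  _ = refl
xor-≡ {false} {false} _ = refl

≡-xor : ∀ {p q} → p ≡ q → p xor q ≡ false
≡-xor {p} refl = xor-same p

xsum-xor : {A : Set} (g h : A → Bool) (L : List A) → xsum (λ i → g i xor h i) L ≡ xsum g L xor xsum h L
xsum-xor g h []      = refl
xsum-xor g h (i ∷ L) = trans (cong ((g i xor h i) xor_) (xsum-xor g h L)) (interchange (g i) (h i) (xsum g L) (xsum h L))

xsum-interleaving : {A : Set} (g : A → Bool) {N R L : List A} → Interleaving N R L →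
                    xsum g L ≡ xsum g N xor xsum g R
xsum-interleaving g [] = refl
xsum-interleaving g {i ∷ N} {R} (consˡ t) = trans (cong (g i xor_) (xsum-interleaving g t)) (sym (xor-assoc (g i) (xsum g N) (xsum g R)))
xsum-interleaving g {N} {i ∷ R} (consʳ t) = trans (cong (g i xor_) (xsum-interleaving g t))
  (trans (sym (xor-assoc (g i) _ _)) (trans (cong (_xor xsum g R) (xor-comm (g i) (xsum g N))) (xor-assoc (xsum g N) _ _)))

<⇒<ᵇ≡true : ∀ {i j} → i < j → (i <ᵇ j) ≡ true
<⇒<ᵇ≡true h = Equivalence.to T-≡ (<⇒<ᵇ h)

≤⇒<ᵇ≡false : ∀ {i j} → j ≤ i → (i <ᵇ j) ≡ false
≤⇒<ᵇ≡false {i} {j} h with i <ᵇ j in eq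
... | false = refl
... | true  = ⊥-elim (<⇒≱ (<ᵇ⇒< i j (Equivalence.from T-≡ eq)) h)

-- The cycle edges that belong to the cut with indicator F.
∂ : (ℕ → Bool) → ℕ → Bool
∂ F i = F i xor F (suc i)

telescope-≤ : ∀ F m b → m ≤ b → xsum (λ i → (i <ᵇ b) ∧ ∂ F i) (downFrom m) ≡ F 0 xor F m
telescope-≤ F zero    b h = sym (xor-same (F 0))
telescope-≤ F (suc m) b h rewrite <⇒<ᵇ≡true h =
  trans (cong (∂ F m xor_) (telescope-≤ F m b (<⇒≤ h))) (cancel (F m) (F (suc m)) (F 0))
  where
  cancel : ∀ p q r → (p xor q) xor (r xor p) ≡ r xor q
  cancel true  true  true  = refl
  cancel true  true  false = refl
  cancel true  false true  = refl
  cancel true  false false = refl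
  cancel false q     r     = trans (cong (q xor_) (xor-identityʳ r)) (xor-comm q r)

telescope-+ : ∀ F b j → xsum (λ i → (i <ᵇ b) ∧ ∂ F i) (downFrom (j + b)) ≡ F 0 xor F b
telescope-+ F b zero    = telescope-≤ F b b ≤-refl
telescope-+ F b (suc j) rewrite ≤⇒<ᵇ≡false (m≤n+m b j) = telescope-+ F b j

telescope : ∀ F {b n} → b ≤ n → xsum (λ i → (i <ᵇ b) ∧ ∂ F i) (downFrom n) ≡ F 0 xor F b
telescope F {b} {n} h =
  subst (λ k → xsum (λ i → (i <ᵇ b) ∧ ∂ F i) (downFrom k) ≡ _) (m∸n+n≡m h) (telescope-+ F b (n ∸ b))

telescope-all : ∀ F n → xsum (∂ F) (downFrom n) ≡ F 0 xor F n
telescope-all F n = trans (xsum-cong (downFrom n) λ i m →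
    sym (cong (_∧ ∂ F i) (<⇒<ᵇ≡true (∈-downFrom⁻ m)))) (telescope F ≤-refl)

-- Cutting the cycle at positions a and b leaves two arcs; `arc a b` is one of them.
arc : ℕ → ℕ → ℕ → Bool
arc a b i = (i <ᵇ a) xor (i <ᵇ b)

-- Two telescoping sums starting at 0, in which `F 0` cancels. A cut therefore avoids the chord from
-- a to b exactly when it is even on the arc.
telescope-arc : ∀ F {a b n} → a ≤ n → b ≤ n → xsum (λ i → arc a b i ∧ ∂ F i) (downFrom n) ≡ F a xor F b
telescope-arc F {a} {b} {n} p q =
  trans (xsum-cong (downFrom n) (λ i _ → Boolₚ.∧-distribʳ-xor (∂ F i) (i <ᵇ a) (i <ᵇ b)))
  (trans (xsum-xor _ _ (downFrom n))
  (trans (cong₂ _xor_ (telescope F p) (telescope F q)) (cancel (F 0) (F a) (F b))))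
  where
  cancel : ∀ r p q → (r xor p) xor (r xor q) ≡ p xor q
  cancel false p q = refl
  cancel true true q = refl
  cancel true false q = Boolₚ.not-involutive q

arcColours : ℕ → ℕ → ℕ → ℕ → ℕ → List Colour
arcColours a b c d n = map (λ i → arc a b i , arc c d i) (downFrom n)

module _ (col : ℕ → Colour) where
  open Parity col

  -- Here and in the next two lemmas a coordinate of the combination of vectors (1,α,β) is expressed
  -- through the four class sums.
  parity-total : ∀ x L → xsum x L ≡ (parity x L c₀₀ xor parity x L c₀₁) xor (parity x L c₁₀ xor parity x L c₁₁)
  parity-total x L = trans (xsum-cong L (λ i _ → pointwise (col i) (x i)))
    (trans (xsum-xor _ _ L) (cong₂ _xor_ (xsum-xor _ _ L) (xsum-xor _ _ L)))
    where
    pointwise : ∀ c b → b ≡ (((c₀₀ ≐ c) ∧ b) xor ((c₀₁ ≐ c) ∧ b)) xor (((c₁₀ ≐ c) ∧ b) xor ((c₁₁ ≐ c) ∧ b))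
    pointwise c₀₀ b = sym (trans (xor-identityʳ _) (xor-identityʳ b))
    pointwise c₀₁ b = sym (xor-identityʳ b)
    pointwise c₁₀ b = sym (xor-identityʳ b)
    pointwise c₁₁ b = refl

  parity-fst : ∀ x L → xsum (λ i → proj₁ (col i) ∧ x i) L ≡ parity x L c₁₀ xor parity x L c₁₁
  parity-fst x L = trans (xsum-cong L (λ i _ → pointwise (col i) (x i))) (xsum-xor _ _ L)
    where
    pointwise : ∀ c b → proj₁ c ∧ b ≡ ((c₁₀ ≐ c) ∧ b) xor ((c₁₁ ≐ c) ∧ b)
    pointwise c₀₀ b = refl
    pointwise c₀₁ b = refl
    pointwise c₁₀ b = sym (xor-identityʳ b)
    pointwise c₁₁ b = refl

  parity-snd : ∀ x L → xsum (λ i → proj₂ (col i) ∧ x i) L ≡ parity x L c₀₁ xor parity x L c₁₁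
  parity-snd x L = trans (xsum-cong L (λ i _ → pointwise (col i) (x i))) (xsum-xor _ _ L)
    where
    pointwise : ∀ c b → proj₂ c ∧ b ≡ ((c₀₁ ≐ c) ∧ b) xor ((c₁₁ ≐ c) ∧ b)
    pointwise c₀₀ b = refl
    pointwise c₀₁ b = sym (xor-identityʳ b)
    pointwise c₁₀ b = refl
    pointwise c₁₁ b = refl

  -- For `x = ∂ F` on the whole cycle these are the conditions that F returns to its initial value
  -- and agrees at the ends of each kept chord.
  Closed : (ℕ → Bool) → List ℕ → Set
  Closed x L = xsum x L ≡ false × xsum (λ i → proj₁ (col i) ∧ x i) L ≡ false
             × xsum (λ i → proj₂ (col i) ∧ x i) L ≡ false

  Balanced⇒Closed : ∀ x L → Balanced (parity x L) → Closed x L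
  Balanced⇒Closed x L bal =
    trans (parity-total x L) (cong₂ _xor_ (≡-xor (bal c₀₀ c₀₁)) (≡-xor (bal c₁₀ c₁₁))) ,
    trans (parity-fst x L) (≡-xor (bal c₁₀ c₁₁)) ,
    trans (parity-snd x L) (≡-xor (bal c₀₁ c₁₁))

  -- Three independent equations in four class sums over F₂ leave only the multiples of (1,1,1,1).
  Closed⇒Balanced : ∀ x L → Closed x L → Balanced (parity x L)
  Closed⇒Balanced x L (t , p , q) c d = trans (to-c₁₁ c) (sym (to-c₁₁ d))
    where
    e₁ = xor-≡ (trans (sym (parity-fst x L)) p)
    to-c₁₁ : ∀ c → parity x L c ≡ parity x L c₁₁
    to-c₁₁ c₁₁ = refl
    to-c₁₁ c₁₀ = e₁
    to-c₁₁ c₀₁ = xor-≡ (trans (sym (parity-snd x L)) q)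
    to-c₁₁ c₀₀ = trans (xor-≡ (trans (sym (xor-identityʳ _)) (trans
      (cong ((parity x L c₀₀ xor parity x L c₀₁) xor_) (sym (≡-xor e₁)))
      (trans (sym (parity-total x L)) t)))) (to-c₁₁ c₀₁)

-- A removed chord puts no condition on a cut, so its coordinate is erased and the classes that
-- differ only there merge.
mask : Bool → Bool → Colour → Colour
mask κ₁ κ₂ (p , q) = κ₁ ∧ p , κ₂ ∧ q

pick : Bool → ℕ → ℕ
pick b k = if b then k else 0

occ-map : (g : Colour → Colour) (d : Colour) (cs : List Colour) → let sel = λ c → if d ≐ g c then occ c cs else 0 in
          occ d (map g cs) ≡ sel c₀₀ + sel c₀₁ + sel c₁₀ + sel c₁₁
occ-map g d [] with d ≐ g c₀₀ | d ≐ g c₀₁ | d ≐ g c₁₀ | d ≐ g c₁₁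
... | p | q | r | s = sym (cong₂ _+_ (cong₂ _+_ (cong₂ _+_ (if-same p) (if-same q)) (if-same r)) (if-same s))
  where
  if-same : ∀ b → (if b then 0 else 0) ≡ 0
  if-same true  = refl
  if-same false = refl
occ-map g d (c ∷ cs) rewrite occ-map g d cs = bump c
  where
  pick-suc : ∀ b k → pick b 1 + pick b k ≡ pick b (suc k)
  pick-suc true  k = refl
  pick-suc false k = refl

  S : ℕ → ℕ → ℕ → ℕ → ℕ
  S p q r s = pick (d ≐ g c₀₀) p + pick (d ≐ g c₀₁) q + pick (d ≐ g c₁₀) r + pick (d ≐ g c₁₁) s
  move₁ : ∀ h p q r s → h + (p + q + r + s) ≡ (h + p) + q + r + s
  move₁ = solve-∀
  move₂ : ∀ h p q r s → h + (p + q + r + s) ≡ p + (h + q) + r + s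
  move₂ = solve-∀
  move₃ : ∀ h p q r s → h + (p + q + r + s) ≡ p + q + (h + r) + s
  move₃ = solve-∀
  move₄ : ∀ h p q r s → h + (p + q + r + s) ≡ p + q + r + (h + s)
  move₄ = solve-∀
  P₁ = pick (d ≐ g c₀₀) (occ c₀₀ cs)
  P₂ = pick (d ≐ g c₀₁) (occ c₀₁ cs)
  P₃ = pick (d ≐ g c₁₀) (occ c₁₀ cs)
  P₄ = pick (d ≐ g c₁₁) (occ c₁₁ cs)
  bump : ∀ c → pick (d ≐ g c) 1 + S (occ c₀₀ cs) (occ c₀₁ cs) (occ c₁₀ cs) (occ c₁₁ cs)
             ≡ S (occ c₀₀ (c ∷ cs)) (occ c₀₁ (c ∷ cs)) (occ c₁₀ (c ∷ cs)) (occ c₁₁ (c ∷ cs))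
  bump c₀₀ = trans (move₁ (pick (d ≐ g c₀₀) 1) P₁ P₂ P₃ P₄) (cong (λ z → z + P₂ + P₃ + P₄) (pick-suc (d ≐ g c₀₀) _))
  bump c₀₁ = trans (move₂ (pick (d ≐ g c₀₁) 1) P₁ P₂ P₃ P₄) (cong (λ z → P₁ + z + P₃ + P₄) (pick-suc (d ≐ g c₀₁) _))
  bump c₁₀ = trans (move₃ (pick (d ≐ g c₁₀) 1) P₁ P₂ P₃ P₄) (cong (λ z → P₁ + P₂ + z + P₄) (pick-suc (d ≐ g c₁₀) _))
  bump c₁₁ = trans (move₄ (pick (d ≐ g c₁₁) 1) P₁ P₂ P₃ P₄) (cong (λ z → P₁ + P₂ + P₃ + z) (pick-suc (d ≐ g c₁₁) _))

-- A constant recolouring merges all four classes into one.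
occ-total : ∀ cs → occ c₀₀ cs + occ c₁₀ cs + occ c₁₁ cs + occ c₀₁ cs ≡ length cs
occ-total cs = trans (rearrange (occ c₀₀ cs) (occ c₁₀ cs) (occ c₁₁ cs) (occ c₀₁ cs))
  (trans (sym (occ-map (λ _ → c₀₀) c₀₀ cs)) (all-c₀₀ cs))
  where
  rearrange : ∀ w x y z → w + x + y + z ≡ w + z + x + y
  rearrange = solve-∀
  all-c₀₀ : ∀ cs → occ c₀₀ (map (λ _ → c₀₀) cs) ≡ length cs
  all-c₀₀ []       = refl
  all-c₀₀ (_ ∷ cs) = cong suc (all-c₀₀ cs)

-- The number of connected spanning subgraphs is this value plus 4 (n + 1); the arguments are the
-- sizes of the classes 00, 10, 11, 01, which is their order on the cycle when the chords cross.
value : ℕ → ℕ → ℕ → ℕ → ℕ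
value w x y z = w * y * (x + z + 3) + x * z * (w + y + 3) + 2 * (w + y) * (x + z)

-- `cnt-independent` is applied to each choice of kept chords, with the classes merged by the mask.
-- Unless both chords are kept, class 11 is empty and Πx vanishes; the one remaining product is
-- added to both sides and cancelled.
cnt-masks : ∀ cs →
  (cnt (independent full) (map (mask false false) cs) + cnt (independent full) (map (mask false true) cs))
  + (cnt (independent full) (map (mask true false) cs) + cnt (independent full) (map (mask true true) cs))
  ≡ value (occ c₀₀ cs) (occ c₁₀ cs) (occ c₁₁ cs) (occ c₀₁ cs) + 4 * suc (length cs)
cnt-masks cs = +-cancelʳ-≡ (w * z * x * y) _ _ (trans
  (split (T false false) (T false true) (T true false) (T true true) (w * z * x * y))
  (trans (cong₂ _+_ (cong₂ _+_ (cong₂ _+_ ff ft) tf) tt)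
  (trans (expand w x y z) (cong (λ k → value w x y z + 4 * suc k + w * z * x * y) (occ-total cs)))))
  where
  w = occ c₀₀ cs
  x = occ c₁₀ cs
  y = occ c₁₁ cs
  z = occ c₀₁ cs
  T : Bool → Bool → ℕ
  T κ₁ κ₂ = cnt (independent full) (map (mask κ₁ κ₂) cs)
  split : ∀ p q r s k → (p + q) + (r + s) + k ≡ p + q + r + (s + k)
  split = solve-∀
  o : ∀ κ₁ κ₂ d → _
  o κ₁ κ₂ d = occ-map (mask κ₁ κ₂) d cs
  Π-cong : ∀ {f g : Colour → ℕ} → (∀ c → f c ≡ g c) → Π₄ f ≡ Π₄ g
  Π-cong h = cong₂ _*_ (cong₂ _*_ (cong₂ _*_ (h c₀₀) (h c₀₁)) (h c₁₀)) (h c₁₁)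
  sel : Bool → Bool → Colour → ℕ
  sel κ₁ κ₂ d = let s = λ c → if d ≐ mask κ₁ κ₂ c then occ c cs else 0 in s c₀₀ + s c₀₁ + s c₁₀ + s c₁₁
  masked : ∀ κ₁ κ₂ → T κ₁ κ₂ + Π₄ (sel κ₁ κ₂) ≡ Π₄ (suc ∘ sel κ₁ κ₂)
  masked κ₁ κ₂ = trans (cong (T κ₁ κ₂ +_) (sym (Π-cong (o κ₁ κ₂)))) (trans (cnt-independent full (map (mask κ₁ κ₂) cs)) (Π-cong (cong suc ∘ o κ₁ κ₂)))
  vanish : ∀ t p {q} → t + p * 0 ≡ q → t ≡ q
  vanish t p e = trans (sym (trans (cong (t +_) (*-zeroʳ p)) (+-identityʳ t))) e
  π : Bool → Bool → ℕ
  π κ₁ κ₂ = sel κ₁ κ₂ c₀₀ * sel κ₁ κ₂ c₀₁ * sel κ₁ κ₂ c₁₀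
  ff : T false false ≡ _
  ff = vanish (T false false) (π false false) (masked false false)
  ft : T false true ≡ _
  ft = vanish (T false true) (π false true) (masked false true)
  tf : T true false ≡ _
  tf = vanish (T true false) (π true false) (masked true false)
  units : ∀ w x y z → w * z * x * y ≡ (w + 0 + 0 + 0) * (0 + z + 0 + 0) * (0 + 0 + x + 0) * (0 + 0 + 0 + y)
  units = solve-∀
  tt : T true true + w * z * x * y ≡ _
  tt = trans (cong (T true true +_) (units w x y z)) (masked true true)
  expand : ∀ w x y z → 
    suc (w + z + x + y) * 1 * 1 * 1 + suc (w + 0 + x + 0) * suc (0 + z + 0 + y) * 1 * 1
    + suc (w + z + 0 + 0) * 1 * suc (0 + 0 + x + y) * 1
    + suc (w + 0 + 0 + 0) * suc (0 + z + 0 + 0) * suc (0 + 0 + x + 0) * suc (0 + 0 + 0 + y)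
    ≡ (w * y * (x + z + 3) + x * z * (w + y + 3) + 2 * (w + y) * (x + z)) + 4 * suc (w + x + y + z) + w * z * x * y
  expand = solve-∀

-- Cuts of a hamiltonian cycle with two chords

mk : ∀ {n} → Fin n → Fin n → Fin n × Fin n
mk u v = if toℕ u <ᵇ toℕ v then (u , v) else (v , u)

mk-cases : ∀ {n} (u v : Fin n) → mk u v ≡ (u , v) ⊎ mk u v ≡ (v , u)
mk-cases u v with toℕ u <ᵇ toℕ v
... | true  = inj₁ refl
... | false = inj₂ refl

mk-constant : ∀ {n} {W : Set} {f : Fin n → W} {u v} → f u ≡ f v → f (proj₁ (mk u v)) ≡ f (proj₂ (mk u v))
mk-constant {u = u} {v} h with toℕ u <ᵇ toℕ v
... | true  = h
... | false = sym h

mk-constant⁻ : ∀ {n} {W : Set} {f : Fin n → W} {u v} → f (proj₁ (mk u v)) ≡ f (proj₂ (mk u v)) → f u ≡ f v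
mk-constant⁻ {u = u} {v} h with toℕ u <ᵇ toℕ v
... | true  = h
... | false = sym h

-- The enumeration is periodic over all natural numbers: every position has a successor, so the
-- closing edge is no special case, and a rotation is an offset.
record CyclicOrder (m : ℕ) : Set where
  field
    vtx    : ℕ → Fin (suc m)
    period : ∀ i → vtx (suc m + i) ≡ vtx i
    surj   : ∀ v → ∃ λ i → vtx i ≡ v
    inj    : ∀ {i j} → vtx i ≡ vtx j → i % suc m ≡ j % suc m

  vtx-% : ∀ i → vtx (i % suc m) ≡ vtx i
  vtx-% i = sym (trans (cong vtx (trans (m≡m%n+[m/n]*n i (suc m)) (+-comm (i % suc m) _))) (multiple (i / suc m)))
    where
    multiple : ∀ q → vtx (q * suc m + i % suc m) ≡ vtx (i % suc m)
    multiple zero    = refl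
    multiple (suc q) = trans (cong vtx (+-assoc (suc m) (q * suc m) _)) (trans (period _) (multiple q))

  pos : Fin (suc m) → ℕ
  pos v = proj₁ (surj v) % suc m

  pos< : ∀ v → pos v < suc m
  pos< v = m%n<n (proj₁ (surj v)) (suc m)

  vtx-pos : ∀ v → vtx (pos v) ≡ v
  vtx-pos v = trans (vtx-% (proj₁ (surj v))) (proj₂ (surj v))

  pos-vtx : ∀ {i} → i < suc m → pos (vtx i) ≡ i
  pos-vtx {i} h = trans (sym (m%n%n≡m%n (proj₁ (surj (vtx i))) (suc m))) (trans (inj (vtx-pos (vtx i))) (m<n⇒m%n≡m h))

  cycleEdge : ℕ → Fin (suc m) × Fin (suc m)
  cycleEdge i = mk (vtx i) (vtx (suc i))

module Chords {m : ℕ} (C : CyclicOrder m) (a b c d : ℕ)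
  (a≤ : a ≤ suc m) (b≤ : b ≤ suc m) (c≤ : c ≤ suc m) (d≤ : d ≤ suc m) where

  open CyclicOrder C

  private
    n = suc m
    V = Fin (suc m)
    E = V × V

  chord₁ chord₂ : E
  chord₁ = mk (vtx a) (vtx b)
  chord₂ = mk (vtx c) (vtx d)

  keep : Bool → E → List E → List E
  keep κ e N = if κ then e ∷ N else N

  kept : Bool → Bool → List ℕ → List E
  kept κ₁ κ₂ N = keep κ₁ chord₁ (keep κ₂ chord₂ (map cycleEdge N))

  colour : Bool → Bool → ℕ → Colour
  colour κ₁ κ₂ i = κ₁ ∧ arc a b i , κ₂ ∧ arc c d i

  module _ (κ₁ κ₂ : Bool) where

    open Parity (colour κ₁ κ₂)

    Constant-kept : ∀ {N} (f : V → Bool) → (κ₁ ≡ true → f (vtx a) ≡ f (vtx b)) →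
      (κ₂ ≡ true → f (vtx c) ≡ f (vtx d)) → (∀ i → i ∈ N → f (vtx i) ≡ f (vtx (suc i))) →
      Constant (kept κ₁ κ₂ N) f
    Constant-kept {N} f h₁ h₂ h = on κ₁ h₁ (on κ₂ h₂ (Allₚ.map⁺ (All.tabulate (λ {i} m → mk-constant {f = f} (h i m)))))
      where
      on : ∀ κ {u v M} → (κ ≡ true → f u ≡ f v) → Constant M f → Constant (keep κ (mk u v) M) f
      on true  h k = mk-constant {f = f} (h refl) ∷ k
      on false h k = k

    Constant-kept⁻ : ∀ {N} (f : V → Bool) → Constant (kept κ₁ κ₂ N) f →
      (κ₁ ≡ true → f (vtx a) ≡ f (vtx b)) × (κ₂ ≡ true → f (vtx c) ≡ f (vtx d)) ×
      (∀ i → i ∈ N → f (vtx i) ≡ f (vtx (suc i)))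
    Constant-kept⁻ {N} f k = proj₁ o₁ , proj₁ o₂ , λ i m → mk-constant⁻ {f = f} (All.lookup (Allₚ.map⁻ (proj₂ o₂)) m)
      where
      on : ∀ κ {u v M} → Constant (keep κ (mk u v) M) f → (κ ≡ true → f u ≡ f v) × Constant M f
      on true  (p ∷ k) = (λ _ → mk-constant⁻ {f = f} p) , k
      on false k       = (λ ()) , k
      o₁ = on κ₁ k
      o₂ = on κ₂ (proj₂ o₁)

    masked-arc : ∀ κ {a b} F → a ≤ n → b ≤ n →
      xsum (λ i → (κ ∧ arc a b i) ∧ ∂ F i) (downFrom n) ≡ κ ∧ (F a xor F b)
    masked-arc true  F p q = telescope-arc F p q
    masked-arc false F p q = xsum-false (downFrom n) (λ _ _ → refl)

    module _ {N R : List ℕ} (int : Interleaving N R (downFrom n)) where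

      restrict : ∀ x → (∀ i → i ∈ N → x i ≡ false) → ∀ c → parity x (downFrom n) c ≡ parity x R c
      restrict x z c = trans (xsum-interleaving _ int) (cong (_xor parity x R c)
        (xsum-false N (λ i m → trans (cong ((c ≐ colour κ₁ κ₂ i) ∧_) (z i m)) (∧-zeroʳ _))))

      -- If f is constant along the kept edges, its coboundary along the cycle is closed and
      -- supported on R. Independence makes it zero, and f is constant along the whole cycle.
      independent⇒Connected : independent full (map (colour κ₁ κ₂) R) ≡ true → Connected (kept κ₁ κ₂ N)
      independent⇒Connected h f k u v = trans (f≡ u) (sym (f≡ v))
        where
        F : ℕ → Bool
        F i = f (vtx i)
        k′ = Constant-kept⁻ f k
        ∂≡0-N : ∀ i → i ∈ N → ∂ F i ≡ false
        ∂≡0-N i m = ≡-xor (proj₂ (proj₂ k′) i m)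
        masked : ∀ κ {p q} → (κ ≡ true → p ≡ q) → κ ∧ (p xor q) ≡ false
        masked true  h = ≡-xor (h refl)
        masked false h = refl
        closed : Closed (colour κ₁ κ₂) (∂ F) (downFrom n)
        closed = trans (telescope-all F n) (≡-xor (cong f (sym (trans (cong vtx (sym (+-identityʳ n))) (period 0))))) ,
                 trans (masked-arc κ₁ F a≤ b≤) (masked κ₁ (proj₁ k′)) ,
                 trans (masked-arc κ₂ F c≤ d≤) (masked κ₂ (proj₁ (proj₂ k′)))
        bal : Balanced (parity (∂ F) R)
        bal c d = trans (sym (restrict (∂ F) ∂≡0-N c))
          (trans (Closed⇒Balanced (colour κ₁ κ₂) (∂ F) (downFrom n) closed c d) (restrict (∂ F) ∂≡0-N d))
        ∂≡0-R = proj₂ (independent⇒trivial full R (∂ F) (λ _ → false) h (λ _ _ → refl) bal)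
        ∂≡0 : ∀ i → i < n → ∂ F i ≡ false
        ∂≡0 i l with ∈-split int (∈-downFrom⁺ l)
        ... | inj₁ m = ∂≡0-N i m
        ... | inj₂ m = All.lookup ∂≡0-R m
        F≡ : ∀ i → i < n → F i ≡ F 0
        F≡ zero    l = refl
        F≡ (suc i) l = trans (sym (xor-≡ (∂≡0 i (<⇒≤ l)))) (F≡ i (<⇒≤ l))
        f≡ : ∀ w → f w ≡ F 0
        f≡ w = trans (cong f (sym (vtx-pos w))) (F≡ (pos w) (pos< w))

      -- A dependency x is integrated along the cycle to F with `∂ F` equal to x. Balance makes F
      -- close up and agree at the ends of each kept chord, so F is a cut indicator constant on the
      -- kept edges; yet it changes at some edge of R.
      Connected⇒independent : Connected (kept κ₁ κ₂ N) → independent full (map (colour κ₁ κ₂) R) ≡ true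
      Connected⇒independent conn with independent full (map (colour κ₁ κ₂) R) in eq
      ... | true  = refl
      ... | false with dependent⇒Dependency full R (Unique-right int (downFrom⁺ n)) eq
      ...   | dep with Dependency.nonzero dep
      -- No colour is used at the outset, so there is no carry.
      ...     | inj₁ (c , t) = ⊥-elim (true≢false t (Dependency.outside dep c refl))
      ...     | inj₂ (i , i∈R , t) = ⊥-elim (true≢false t (trans (sym (∂F i))
                  (≡-xor (trans (sym (fF (<⇒≤ i<n))) (trans (conn f const (vtx i) (vtx (suc i))) (fF i<n))))))
        where
        open Dependency dep
        i<n : i < n
        i<n = ∈-downFrom⁻ (∈-right int i∈R)
        F : ℕ → Bool
        F zero    = false
        F (suc j) = F j xor x j
        ∂F : ∀ j → ∂ F j ≡ x j
        ∂F j = trans (sym (xor-assoc (F j) (F j) (x j))) (cong (_xor x j) (xor-same (F j)))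
        x≡0-N : ∀ j → j ∈ N → x j ≡ false
        x≡0-N j m = support j (left∉right int (downFrom⁺ n) m)
        bal : Balanced (parity x (downFrom n))
        bal c d = trans (restrict x x≡0-N c) (trans
          (subst₂ (λ p q → p xor parity x R c ≡ q xor parity x R d) (outside c refl) (outside d refl) (balanced c d))
          (sym (restrict x x≡0-N d)))
        closed = Balanced⇒Closed (colour κ₁ κ₂) x (downFrom n) bal
        F0≡Fn : F 0 ≡ F n
        F0≡Fn = xor-≡ (trans (sym (telescope-all F n)) (trans (xsum-cong (downFrom n) (λ j _ → ∂F j)) (proj₁ closed)))
        unmask : ∀ κ {a b} → a ≤ n → b ≤ n → xsum (λ i → (κ ∧ arc a b i) ∧ x i) (downFrom n) ≡ false →
                 κ ≡ true → F a ≡ F b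
        unmask true {a} {b} p q h refl = xor-≡ (trans (sym (telescope-arc F p q))
          (trans (xsum-cong (downFrom n) (λ j _ → cong (arc a b j ∧_) (∂F j))) h))
        f : V → Bool
        f v = F (pos v)
        -- The case j = n has to be covered, since the last cycle edge ends at position n, the same
        -- vertex as position 0.
        fF : ∀ {j} → j ≤ n → f (vtx j) ≡ F j
        fF {j} l with m≤n⇒m<n∨m≡n l
        ... | inj₁ j<n  = cong F (pos-vtx j<n)
        ... | inj₂ refl = trans (cong f (trans (cong vtx (sym (+-identityʳ n))) (period 0)))
                            (trans (cong F (pos-vtx (s≤s z≤n))) F0≡Fn)
        const : Constant (kept κ₁ κ₂ N) f
        const = Constant-kept f
          (λ e → trans (fF a≤) (trans (unmask κ₁ a≤ b≤ (proj₁ (proj₂ closed)) e) (sym (fF b≤))))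
          (λ e → trans (fF c≤) (trans (unmask κ₂ c≤ d≤ (proj₂ (proj₂ closed)) e) (sym (fF d≤))))
          (λ j m → let l = ∈-downFrom⁻ (∈-left int m) in
            trans (fF (<⇒≤ l)) (trans (xor-≡ (trans (∂F j) (x≡0-N j m))) (sym (fF l))))

    -- Connectedness is tested on the kept edges and independence on the removed ones, hence the
    -- passage to complements.
    cnt-kept : cnt (λ N → connected? n (kept κ₁ κ₂ N)) (downFrom n)
             ≡ cnt (independent full) (map (colour κ₁ κ₂) (downFrom n))
    cnt-kept = trans (cnt-complement (downFrom n) (λ int → ⇔⇒≡
        (λ h → Connected⇒independent int (connected?⇒Connected _ h))
        (λ h → Connected⇒connected? _ (independent⇒Connected int h))))
      (sym (cnt-map (independent full) (colour κ₁ κ₂) (downFrom n)))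

  arcs : List Colour
  arcs = arcColours a b c d n

  -- The first two steps of the count decide on the chords; each of the four resulting terms has its
  -- own mask.
  cnt-connected : cnt (connected? n) (chord₁ ∷ chord₂ ∷ map cycleEdge (downFrom n))
    ≡ value (occ c₀₀ arcs) (occ c₁₀ arcs) (occ c₁₁ arcs) (occ c₀₁ arcs) + 4 * suc n
  cnt-connected = trans
    (cong₂ _+_ (cong₂ _+_ (term false false) (term false true)) (cong₂ _+_ (term true false) (term true true)))
    (trans (cnt-masks arcs) (cong (λ k → value (occ c₀₀ arcs) (occ c₁₀ arcs) (occ c₁₁ arcs) (occ c₀₁ arcs) + 4 * suc k)
      (trans (length-map _ (downFrom n)) (length-downFrom n))))
    where
    term : ∀ κ₁ κ₂ → cnt (λ N → connected? n (keep κ₁ chord₁ (keep κ₂ chord₂ N))) (map cycleEdge (downFrom n))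
                   ≡ cnt (independent full) (map (mask κ₁ κ₂) arcs)
    term κ₁ κ₂ = trans (cnt-map _ cycleEdge (downFrom n))
      (trans (cnt-kept κ₁ κ₂) (cong (cnt (independent full)) (map-∘ (downFrom n))))

-- Class sizes for a given position of the chords

occ-segment : (col : ℕ → Colour) (c₀ c : Colour) (lo j : ℕ) → (∀ i → lo ≤ i → i < j + lo → col i ≡ c₀) →
  occ c (map col (downFrom (j + lo))) ≡ pick (c ≐ c₀) j + occ c (map col (downFrom lo))
occ-segment col c₀ c lo zero    h with c ≐ c₀
... | true  = refl
... | false = refl
occ-segment col c₀ c lo (suc j) h
  rewrite h (j + lo) (m≤n+m lo j) ≤-refl
        | occ-segment col c₀ c lo j (λ i p q → h i p (m≤n⇒m≤1+n q)) with c ≐ c₀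
... | true  = refl
... | false = refl

module _ (g : Bool → Bool → Bool → Bool → Colour) (p₀ w x y r : ℕ) where
  private
    p₁ = w + p₀
    p₂ = x + p₁
    p₃ = y + p₂

  -- `g` reads the colour off the comparisons with the four chord ends in increasing order, so
  -- crossing, nested and disjoint chords differ only in `g`.
  occ-four : ∀ c → occ c (map (λ i → g (i <ᵇ p₀) (i <ᵇ p₁) (i <ᵇ p₂) (i <ᵇ p₃)) (downFrom (r + p₃)))
    ≡ pick (c ≐ g false false false false) r + (pick (c ≐ g false false false true) y
    + (pick (c ≐ g false false true true) x + (pick (c ≐ g false true true true) w
    + pick (c ≐ g true true true true) p₀)))
  occ-four c =
    trans (occ-segment col (g false false false false) c p₃ r λ i l _ →
      colour (≤⇒<ᵇ≡false (≤-trans p₀≤p₃ l)) (≤⇒<ᵇ≡false (≤-trans p₁≤p₃ l)) (≤⇒<ᵇ≡false (≤-trans p₂≤p₃ l)) (≤⇒<ᵇ≡false l))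
    (cong (_ +_) (trans (occ-segment col (g false false false true) c p₂ y λ i l h →
      colour (≤⇒<ᵇ≡false (≤-trans p₀≤p₂ l)) (≤⇒<ᵇ≡false (≤-trans p₁≤p₂ l)) (≤⇒<ᵇ≡false l) (<⇒<ᵇ≡true h))
    (cong (_ +_) (trans (occ-segment col (g false false true true) c p₁ x λ i l h →
      colour (≤⇒<ᵇ≡false (≤-trans p₀≤p₁ l)) (≤⇒<ᵇ≡false l) (<⇒<ᵇ≡true h) (<⇒<ᵇ≡true (≤-trans h p₂≤p₃)))
    (cong (_ +_) (trans (occ-segment col (g false true true true) c p₀ w λ i l h →
      colour (≤⇒<ᵇ≡false l) (<⇒<ᵇ≡true h) (<⇒<ᵇ≡true (≤-trans h p₁≤p₂)) (<⇒<ᵇ≡true (≤-trans h p₁≤p₃)))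
    (cong (_ +_) first)))))))
    where
    col : ℕ → Colour
    col i = g (i <ᵇ p₀) (i <ᵇ p₁) (i <ᵇ p₂) (i <ᵇ p₃)
    p₀≤p₁ = m≤n+m p₀ w
    p₁≤p₂ = m≤n+m p₁ x
    p₂≤p₃ = m≤n+m p₂ y
    p₀≤p₂ = ≤-trans p₀≤p₁ p₁≤p₂
    p₁≤p₃ = ≤-trans p₁≤p₂ p₂≤p₃
    p₀≤p₃ = ≤-trans p₀≤p₂ p₂≤p₃
    colour : ∀ {i b₀ b₁ b₂ b₃} → (i <ᵇ p₀) ≡ b₀ → (i <ᵇ p₁) ≡ b₁ → (i <ᵇ p₂) ≡ b₂ → (i <ᵇ p₃) ≡ b₃ →
             col i ≡ g b₀ b₁ b₂ b₃
    colour refl refl refl refl = refl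
    first : occ c (map col (downFrom p₀)) ≡ pick (c ≐ g true true true true) p₀
    first = trans (cong (λ k → occ c (map col (downFrom k))) (sym (+-identityʳ p₀)))
      (trans (occ-segment col (g true true true true) c 0 p₀ λ i _ h →
        let h′ = subst (i <_) (+-identityʳ p₀) h in
        colour (<⇒<ᵇ≡true h′) (<⇒<ᵇ≡true (≤-trans h′ p₀≤p₁)) (<⇒<ᵇ≡true (≤-trans h′ p₀≤p₂)) (<⇒<ᵇ≡true (≤-trans h′ p₀≤p₃)))
      (+-identityʳ _))

-- Optimisation

pattern α₀ = Fin.zero
pattern α₁ = Fin.suc Fin.zero
pattern α₂ = Fin.suc (Fin.suc Fin.zero)
pattern α₃ = Fin.suc (Fin.suc (Fin.suc Fin.zero))

value′ : ℕ × ℕ × ℕ × ℕ → ℕ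
value′ (w , x , y , z) = value w x y z

-- What `16 * value` lacks to n² (n + 14), which is attained when all classes have size n / 4. The
-- first summand penalises unequal sums of opposite pairs, the other two unequal members of a pair.
deficit : ℕ → ℕ → ℕ → ℕ → ℕ → ℕ
deficit s t d u v = d * d * (s + t + 2) + (4 * (u * u) * (t + 3) + 4 * (v * v) * (s + 3))

-- s and t are the total lengths of the two pairs of opposite segments, d = s - t,
-- and u, v are the differences within the pairs.
value-deficit : ∀ {s t} m₁ u m₂ v d → s ≡ 2 * m₁ + u → t ≡ 2 * m₂ + v → s ≡ t + d →
  16 * value m₁ m₂ (m₁ + u) (m₂ + v) + deficit s t d u v ≡ (s + t) * (s + t) * (s + t + 14)
value-deficit {s} {t} m₁ u m₂ v d hs ht hd =
  trans (swap (16 * value m₁ m₂ (m₁ + u) (m₂ + v)) (d * d * (s + t + 2)) _)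
  (trans (cong (_+ d * d * (s + t + 2)) (step₁ hs ht)) (step₂ hd))
  where
  swap : ∀ a b c → a + (b + c) ≡ a + c + b
  swap = solve-∀
  G : ℕ → ℕ → ℕ
  G s t = s * s * (t + 3) + t * t * (s + 3) + 8 * s * t
  -- Within a pair, four times the product is the square of the sum minus the square of the
  -- difference.
  ring₁ : ∀ m₁ u m₂ v →
    16 * (m₁ * (m₁ + u) * (m₂ + (m₂ + v) + 3) + m₂ * (m₂ + v) * (m₁ + (m₁ + u) + 3) + 2 * (m₁ + (m₁ + u)) * (m₂ + (m₂ + v)))
    + (4 * (u * u) * (2 * m₂ + v + 3) + 4 * (v * v) * (2 * m₁ + u + 3))
    ≡ 4 * ((2 * m₁ + u) * (2 * m₁ + u) * (2 * m₂ + v + 3) + (2 * m₂ + v) * (2 * m₂ + v) * (2 * m₁ + u + 3) + 8 * (2 * m₁ + u) * (2 * m₂ + v))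
  ring₁ = solve-∀
  step₁ : ∀ {s t} → s ≡ 2 * m₁ + u → t ≡ 2 * m₂ + v →
    16 * value m₁ m₂ (m₁ + u) (m₂ + v) + (4 * (u * u) * (t + 3) + 4 * (v * v) * (s + 3)) ≡ 4 * G s t
  step₁ refl refl = ring₁ m₁ u m₂ v
  -- The square in s - t is completed.
  ring₂ : ∀ t d → 4 * ((t + d) * (t + d) * (t + 3) + t * t * (t + d + 3) + 8 * (t + d) * t) + d * d * (t + d + t + 2)
    ≡ (t + d + t) * (t + d + t) * (t + d + t + 14)
  ring₂ = solve-∀
  step₂ : ∀ {s} → s ≡ t + d → 4 * G s t + d * d * (s + t + 2) ≡ (s + t) * (s + t) * (s + t + 14)
  step₂ refl = ring₂ t d

-- The deficits of the stated vectors, for which (d, u, v) is (0,0,0), (1,1,0), (2,0,0) and (1,0,1).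
minDeficit : ℕ → Fin 4 → ℕ
minDeficit k α₀ = 0
minDeficit k α₁ = 12 * k + 15
minDeficit k α₂ = 16 * k + 16
minDeficit k α₃ = 12 * k + 25

cpaths-deficit : ∀ k α → let n = 4 * k + toℕ α in
  16 * value′ (cpaths k α) + minDeficit k α ≡ n * n * (n + 14)
cpaths-deficit k α₀ = ring k
  where
  ring : ∀ k → 16 * (k * k * (k + k + 3) + k * k * (k + k + 3) + 2 * (k + k) * (k + k)) + 0
       ≡ (4 * k + 0) * (4 * k + 0) * (4 * k + 0 + 14)
  ring = solve-∀
cpaths-deficit k α₁ = ring k
  where
  ring : ∀ k → 16 * (suc k * k * (k + k + 3) + k * k * (suc k + k + 3) + 2 * (suc k + k) * (k + k)) + (12 * k + 15)
       ≡ (4 * k + 1) * (4 * k + 1) * (4 * k + 1 + 14)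
  ring = solve-∀
cpaths-deficit k α₂ = ring k
  where
  ring : ∀ k → 16 * (suc k * suc k * (k + k + 3) + k * k * (suc k + suc k + 3) + 2 * (suc k + suc k) * (k + k)) + (16 * k + 16)
       ≡ (4 * k + 2) * (4 * k + 2) * (4 * k + 2 + 14)
  ring = solve-∀
cpaths-deficit k α₃ = ring k
  where
  ring : ∀ k → 16 * (suc k * suc k * (suc k + k + 3) + suc k * k * (suc k + suc k + 3) + 2 * (suc k + suc k) * (suc k + k)) + (12 * k + 25)
       ≡ (4 * k + 3) * (4 * k + 3) * (4 * k + 3 + 14)
  ring = solve-∀

-- For each pair of opposite segments its smaller length and its difference; a pair with the larger
-- sum comes first.
balanced-split : ℕ → Fin 4 → (ℕ × ℕ) × (ℕ × ℕ)
balanced-split k α₀ = (k , 0) , (k , 0)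
balanced-split k α₁ = (k , 1) , (k , 0)
balanced-split k α₂ = (suc k , 0) , (k , 0)
balanced-split k α₃ = (suc k , 0) , (k , 1)

private
  -- Naming the slack r turns a strict inequality between polynomials into a ring identity.
  too-big : ∀ {A B} r → A ≤ B → suc B + r ≡ A → ⊥
  too-big {A} {B} r le eq = <-irrefl refl (≤-trans (m≤m+n (suc B) r) (≤-trans (≤-reflexive eq) le))

  parity-clash : ∀ {a b} p q → a ≡ 2 * p → b ≡ suc (2 * q) → a ≡ b → ⊥
  parity-clash p q refl refl e = even≢odd p q e

  half : ∀ {a} p q → a ≡ 2 * p → a ≡ 2 * q → p ≡ q
  half p q e f = *-cancelˡ-≡ p q 2 (trans (sym e) f)

  square-vanishes : ∀ u p → 4 * (u * u) * (p + 3) ≤ 0 → u ≡ 0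
  square-vanishes zero    p h = refl
  square-vanishes (suc u) p h = ⊥-elim (too-big _ h (ring u p))
    where
    ring : ∀ u p → 1 + (11 + 24 * u + 12 * u * u + 4 * p * (1 + u) * (1 + u)) ≡ 4 * (suc u * suc u) * (p + 3)
    ring = solve-∀

  0+ : ∀ a → a + 0 ≡ a
  0+ = +-identityʳ

module _ (k m₁ u m₂ v d : ℕ) {s t : ℕ} (hs : s ≡ 2 * m₁ + u) (ht : t ≡ 2 * m₂ + v) (hd : s ≡ t + d) where

  -- Sixteen times the value plus the deficit is n² (n + 14) for both vectors, so a larger value
  -- means a smaller deficit.
  deficit-bound : ∀ α → s + t ≡ 4 * k + toℕ α → value′ (cpaths k α) ≤ value m₁ m₂ (m₁ + u) (m₂ + v) →
                  deficit s t d u v ≤ minDeficit k α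
  deficit-bound α hn le = +-cancelˡ-≤ (16 * value′ (cpaths k α)) _ _ (begin
    16 * value′ (cpaths k α) + deficit s t d u v          ≤⟨ +-monoˡ-≤ _ (*-monoʳ-≤ 16 le) ⟩
    16 * value m₁ m₂ (m₁ + u) (m₂ + v) + deficit s t d u v ≡⟨ value-deficit m₁ u m₂ v d hs ht hd ⟩
    (s + t) * (s + t) * (s + t + 14)                       ≡⟨ cong (λ n → n * n * (n + 14)) hn ⟩
    (4 * k + toℕ α) * (4 * k + toℕ α) * (4 * k + toℕ α + 14) ≡⟨ sym (cpaths-deficit k α) ⟩
    16 * value′ (cpaths k α) + minDeficit k α              ∎)
    where open ≤-Reasoning

private
  even-part : ∀ m p → 2 * p ≡ 2 * m + 0 → m ≡ p
  even-part m p e = sym (half p m refl (trans e (0+ (2 * m))))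

  odd-part : ∀ m p → 2 * p + 1 ≡ 2 * m + 1 → m ≡ p
  odd-part m p e = *-cancelˡ-≡ m p 2 (+-cancelʳ-≡ 1 _ _ (sym e))

  odd≢0 : ∀ {ℓ} {A : Set ℓ} m p → 2 * p + 1 ≡ 2 * m + 0 → A
  odd≢0 m p e = ⊥-elim (parity-clash m p refl (+-comm _ 1) (sym (trans e (0+ (2 * m)))))

  odd≢2 : ∀ {ℓ} {A : Set ℓ} m p → 2 * p + 1 ≡ 2 * m + 2 → A
  odd≢2 m p e = ⊥-elim (parity-clash (m + 1) p (ring m) (+-comm _ 1) (sym e))
    where
    ring : ∀ m → 2 * m + 2 ≡ 2 * (m + 1)
    ring = solve-∀

  two-more : ∀ k → 2 * k + 2 ≡ 2 * suc k
  two-more = solve-∀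

  nine : ∀ b e → 36 * b ≤ 4 * ((3 + e) * (3 + e)) * b
  nine b e = *-monoˡ-≤ b (*-monoʳ-≤ 4 (*-mono-≤ {3} (m≤m+n 3 e) (m≤m+n 3 e)))

  square-pos : ∀ u b → 4 * b ≤ 4 * (suc u * suc u) * b
  square-pos u b = *-monoˡ-≤ b (*-monoʳ-≤ 4 {1} {suc u * suc u} (s≤s z≤n))

  -- A difference d = 3 + e already costs at least 9 (n + 2), more than each minimal deficit.
  far : ∀ k α {n} e r → n ≡ 4 * k + toℕ α → (3 + e) * (3 + e) * (n + 2) + r ≤ minDeficit k α → ⊥
  far k α {n} e r hn le = absurd α (subst (λ j → 9 * (j + 2) ≤ minDeficit k α) hn
      (≤-trans (*-monoˡ-≤ (n + 2) (*-mono-≤ {3} (m≤m+n 3 e) (m≤m+n 3 e))) (≤-trans (m≤m+n _ r) le)))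
    where
    r₀ : ∀ k → suc 0 + (36 * k + 17) ≡ 9 * (4 * k + 0 + 2)
    r₀ = solve-∀
    r₁ : ∀ k → suc (12 * k + 15) + (24 * k + 11) ≡ 9 * (4 * k + 1 + 2)
    r₁ = solve-∀
    r₂ : ∀ k → suc (16 * k + 16) + (20 * k + 19) ≡ 9 * (4 * k + 2 + 2)
    r₂ = solve-∀
    r₃ : ∀ k → suc (12 * k + 25) + (24 * k + 19) ≡ 9 * (4 * k + 3 + 2)
    r₃ = solve-∀
    absurd : ∀ α → 9 * (4 * k + toℕ α + 2) ≤ minDeficit k α → ⊥
    absurd α₀ h = too-big _ h (r₀ k)
    absurd α₁ h = too-big _ h (r₁ k)
    absurd α₂ h = too-big _ h (r₂ k)
    absurd α₃ h = too-big _ h (r₃ k)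

  Split : ℕ → Fin 4 → ℕ → ℕ → ℕ → ℕ → Set
  Split k α m₁ u m₂ v = ((m₁ , u) , (m₂ , v)) ≡ balanced-split k α

  ×-≡ : ∀ {a b c d a′ b′ c′ d′ : ℕ} → a ≡ a′ → b ≡ b′ → c ≡ c′ → d ≡ d′ → ((a , b) , (c , d)) ≡ ((a′ , b′) , (c′ , d′))
  ×-≡ refl refl refl refl = refl

  even-part′ : ∀ m p {u} → u ≡ 0 → 2 * p ≡ 2 * m + u → m ≡ p
  even-part′ m p refl e = even-part m p e

  Q R : ℕ → ℕ → ℕ
  Q u t = 4 * (u * u) * (t + 3)
  R v s = 4 * (v * v) * (s + 3)

  left-small : ∀ u t v s → Q u t + R v s ≤ 0 → u ≡ 0
  left-small u t v s h = square-vanishes u t (m+n≤o⇒m≤o (Q u t) h)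

  right-small : ∀ u t v s → Q u t + R v s ≤ 0 → v ≡ 0
  right-small u t v s h = square-vanishes v s (m+n≤o⇒n≤o (Q u t) h)

  -- Once the part A of the deficit exhausts the budget C, nothing is left for B.
  residue : ∀ A {B C} → A + B ≡ C → C ≤ A → B ≤ 0
  residue A {B} {C} e le = +-cancelˡ-≤ A B 0 (≤-trans (≤-reflexive e) (≤-trans le (≤-reflexive (sym (0+ A)))))

  split₀ : ∀ k m₁ u m₂ v {s t} → s ≡ 2 * k → t ≡ 2 * k → s ≡ 2 * m₁ + u → t ≡ 2 * m₂ + v →
    deficit s t 0 u v ≤ 0 → Split k α₀ m₁ u m₂ v
  split₀ k m₁ u m₂ v {s} {t} es et hs ht le =
    ×-≡ (even-part′ m₁ k u≡0 (trans (sym es) hs)) u≡0 (even-part′ m₂ k v≡0 (trans (sym et) ht)) v≡0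
    where
    u≡0 = left-small u t v s le
    v≡0 = right-small u t v s le

  -- As s is odd, so is u. From u = 3 on its term alone exceeds the budget, while d = 1 and u = 1
  -- cost exactly 12 k + 15 and leave nothing for v.
  split₁ : ∀ k m₁ u m₂ v {s t} → s ≡ 2 * k + 1 → t ≡ 2 * k → s ≡ 2 * m₁ + u → t ≡ 2 * m₂ + v →
    deficit s t 1 u v ≤ 12 * k + 15 → Split k α₁ m₁ u m₂ v
  split₁ k m₁ 0 m₂ v es et hs ht le = odd≢0 m₁ k (trans (sym es) hs)
  split₁ k m₁ 2 m₂ v es et hs ht le = odd≢2 m₁ k (trans (sym es) hs)
  split₁ k m₁ (suc (suc (suc e))) m₂ v {s} {t} es et hs ht le = ⊥-elim (too-big (60 * k + 92)
    (≤-trans (nine (t + 3) e) (m+n≤o⇒m≤o (Q (3 + e) t) (m+n≤o⇒n≤o (1 * 1 * (s + t + 2)) le)))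
    (trans (ring k) (cong (λ t → 36 * (t + 3)) (sym et))))
    where
    ring : ∀ k → suc (12 * k + 15) + (60 * k + 92) ≡ 36 * (2 * k + 3)
    ring = solve-∀
  split₁ k m₁ 1 m₂ v {s} {t} es et hs ht le =
    ×-≡ (odd-part m₁ k (trans (sym es) hs)) refl (even-part′ m₂ k v≡0 (trans (sym et) ht)) v≡0
    where
    ring : ∀ k x → 12 * k + 15 + x ≡ 1 * 1 * (2 * k + 1 + 2 * k + 2) + (4 * (1 * 1) * (2 * k + 3) + x)
    ring = solve-∀
    v≡0 : v ≡ 0
    v≡0 = square-vanishes v s (residue (12 * k + 15) (trans (ring k (R v s))
      (cong₂ (λ s′ t → 1 * 1 * (s′ + t + 2) + (Q 1 t + R v s)) (sym es) (sym et))) le)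

  -- The square of d = 2 alone costs 4 (n + 2), which is the whole budget.
  split₂ : ∀ k m₁ u m₂ v {s t} → s ≡ 2 * k + 2 → t ≡ 2 * k → s ≡ 2 * m₁ + u → t ≡ 2 * m₂ + v →
    deficit s t 2 u v ≤ 16 * k + 16 → Split k α₂ m₁ u m₂ v
  split₂ k m₁ u m₂ v {s} {t} es et hs ht le =
    ×-≡ (even-part′ m₁ (suc k) u≡0 (trans (sym (two-more k)) (trans (sym es) hs))) u≡0
        (even-part′ m₂ k v≡0 (trans (sym et) ht)) v≡0
    where
    ring : ∀ k x → 16 * k + 16 + x ≡ 2 * 2 * (2 * k + 2 + 2 * k + 2) + x
    ring = solve-∀
    rest≤0 : Q u t + R v s ≤ 0
    rest≤0 = residue (16 * k + 16) (trans (ring k (Q u t + R v s))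
      (cong₂ (λ s′ t′ → 2 * 2 * (s′ + t′ + 2) + (Q u t + R v s)) (sym es) (sym et))) le
    u≡0 = left-small u t v s rest≤0
    v≡0 = right-small u t v s rest≤0

  -- Both u and v are odd here, so both remaining summands are positive.
  split₂-equal : ∀ k m₁ u m₂ v {s t} → s ≡ 2 * k + 1 → t ≡ 2 * k + 1 → s ≡ 2 * m₁ + u → t ≡ 2 * m₂ + v →
    deficit s t 0 u v ≤ 16 * k + 16 → ⊥
  split₂-equal k m₁ 0       m₂ v       es et hs ht le = odd≢0 m₁ k (trans (sym es) hs)
  split₂-equal k m₁ (suc u) m₂ 0       es et hs ht le = odd≢0 m₂ k (trans (sym et) ht)
  split₂-equal k m₁ (suc u) m₂ (suc v) {s} {t} es et hs ht le = too-big 15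
    (≤-trans (+-mono-≤ (square-pos u (t + 3)) (square-pos v (s + 3))) le)
    (trans (ring k) (cong₂ (λ s t → 4 * (t + 3) + 4 * (s + 3)) (sym es) (sym et)))
    where
    ring : ∀ k → suc (16 * k + 16) + 15 ≡ 4 * (2 * k + 1 + 3) + 4 * (2 * k + 1 + 3)
    ring = solve-∀

  -- As in `split₁` with the two pairs exchanged: now t is odd, and d = 1 with v = 1 exhausts the
  -- budget.
  split₃ : ∀ k m₁ u m₂ v {s t} → s ≡ 2 * k + 2 → t ≡ 2 * k + 1 → s ≡ 2 * m₁ + u → t ≡ 2 * m₂ + v →
    deficit s t 1 u v ≤ 12 * k + 25 → Split k α₃ m₁ u m₂ v
  split₃ k m₁ u m₂ 0 es et hs ht le = odd≢0 m₂ k (trans (sym et) ht)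
  split₃ k m₁ u m₂ 2 es et hs ht le = odd≢2 m₂ k (trans (sym et) ht)
  split₃ k m₁ u m₂ (suc (suc (suc e))) {s} {t} es et hs ht le = ⊥-elim (too-big (60 * k + 154)
    (≤-trans (nine (s + 3) e) (m+n≤o⇒n≤o (Q u t) (m+n≤o⇒n≤o (1 * 1 * (s + t + 2)) le)))
    (trans (ring k) (cong (λ s → 36 * (s + 3)) (sym es))))
    where
    ring : ∀ k → suc (12 * k + 25) + (60 * k + 154) ≡ 36 * (2 * k + 2 + 3)
    ring = solve-∀
  split₃ k m₁ u m₂ 1 {s} {t} es et hs ht le =
    ×-≡ (even-part′ m₁ (suc k) u≡0 (trans (sym (two-more k)) (trans (sym es) hs))) u≡0
        (odd-part m₂ k (trans (sym et) ht)) refl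
    where
    ring : ∀ k x → 12 * k + 25 + x ≡ 1 * 1 * (2 * k + 2 + (2 * k + 1) + 2) + (x + 4 * (1 * 1) * (2 * k + 2 + 3))
    ring = solve-∀
    u≡0 : u ≡ 0
    u≡0 = square-vanishes u t (residue (12 * k + 25) (trans (ring k (Q u t))
      (cong₂ (λ s t′ → 1 * 1 * (s + t′ + 2) + (Q u t + R 1 s)) (sym es) (sym et))) le)

  solve-t : ∀ t p d {N} → t + d + t ≡ N → 2 * p + d ≡ N → t ≡ p
  solve-t t p d h e = *-cancelˡ-≡ t p 2 (+-cancelʳ-≡ d _ _ (trans (ring t d) (trans h (sym e))))
    where
    ring : ∀ t d → 2 * t + d ≡ t + d + t
    ring = solve-∀

-- Since d has the parity of n and d ≥ 3 is excluded by `far`, only d = 0 and d = 2 remain for even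
-- n and d = 1 for odd n. For α = 0 the cost of d = 2 is positive; for α = 2 the choice d = 0 makes
-- both pair sums odd.
optimal-split : ∀ k α {s t} m₁ u m₂ v d → s ≡ 2 * m₁ + u → t ≡ 2 * m₂ + v → s ≡ t + d → s + t ≡ 4 * k + toℕ α →
  deficit s t d u v ≤ minDeficit k α → ((m₁ , u) , (m₂ , v)) ≡ balanced-split k α
optimal-split k α {s} {t} m₁ u m₂ v d hs ht hd hn = go α d hd (trans (cong (_+ t) (sym hd)) hn) hn
  where
  odd-t : ∀ t → t + 1 + t ≡ suc (2 * t)
  odd-t = solve-∀
  even-t : ∀ t → t + 2 + t ≡ 2 * suc t
  even-t = solve-∀
  zero-t : ∀ t → t + 0 + t ≡ 2 * t
  zero-t = solve-∀
  r₀ : ∀ k → 4 * k + 0 ≡ 2 * (2 * k)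
  r₀ = solve-∀
  r₁ : ∀ k → 4 * k + 1 ≡ suc (2 * (2 * k))
  r₁ = solve-∀
  r₂ : ∀ k → 4 * k + 2 ≡ 2 * (2 * k + 1)
  r₂ = solve-∀
  r₃ : ∀ k → 4 * k + 3 ≡ suc (2 * (2 * k + 1))
  r₃ = solve-∀
  t₀ : ∀ k → 2 * (2 * k) + 0 ≡ 4 * k + 0
  t₀ = solve-∀
  t₁ : ∀ k → 2 * (2 * k) + 1 ≡ 4 * k + 1
  t₁ = solve-∀
  t₂ : ∀ k → 2 * (2 * k) + 2 ≡ 4 * k + 2
  t₂ = solve-∀
  t₂′ : ∀ k → 2 * (2 * k + 1) + 0 ≡ 4 * k + 2
  t₂′ = solve-∀
  t₃ : ∀ k → 2 * (2 * k + 1) + 1 ≡ 4 * k + 3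
  t₃ = solve-∀
  big : ∀ n → suc 0 + (4 * n + 7) ≡ 2 * 2 * (n + 2)
  big = solve-∀
  go : ∀ α d → s ≡ t + d → t + d + t ≡ 4 * k + toℕ α → s + t ≡ 4 * k + toℕ α →
       deficit s t d u v ≤ minDeficit k α → Split k α m₁ u m₂ v
  go α (suc (suc (suc e))) hd hn′ hn le = ⊥-elim (far k α e (Q u t + R v s) hn le)
  go α₀ 0 hd hn′ hn le = split₀ k m₁ u m₂ v (trans hd (trans (0+ t) et)) et hs ht le
    where et = solve-t t (2 * k) 0 hn′ (t₀ k)
  go α₀ 1 hd hn′ hn le = ⊥-elim (parity-clash (2 * k) t (r₀ k) (odd-t t) (sym hn′))
  go α₀ 2 hd hn′ hn le = ⊥-elim (too-big _ (m+n≤o⇒m≤o (2 * 2 * (s + t + 2)) le) (big (s + t)))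
  go α₁ 0 hd hn′ hn le = ⊥-elim (parity-clash t (2 * k) (zero-t t) (r₁ k) hn′)
  go α₁ 1 hd hn′ hn le = split₁ k m₁ u m₂ v (trans hd (cong (_+ 1) et)) et hs ht le
    where et = solve-t t (2 * k) 1 hn′ (t₁ k)
  go α₁ 2 hd hn′ hn le = ⊥-elim (parity-clash (suc t) (2 * k) (even-t t) (r₁ k) hn′)
  go α₂ 0 hd hn′ hn le = ⊥-elim (split₂-equal k m₁ u m₂ v (trans hd (trans (0+ t) et)) et hs ht le)
    where et = solve-t t (2 * k + 1) 0 hn′ (t₂′ k)
  go α₂ 1 hd hn′ hn le = ⊥-elim (parity-clash (2 * k + 1) t (r₂ k) (odd-t t) (sym hn′))
  go α₂ 2 hd hn′ hn le = split₂ k m₁ u m₂ v (trans hd (cong (_+ 2) et)) et hs ht le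
    where et = solve-t t (2 * k) 2 hn′ (t₂ k)
  go α₃ 0 hd hn′ hn le = ⊥-elim (parity-clash t (2 * k + 1) (zero-t t) (r₃ k) hn′)
  go α₃ 1 hd hn′ hn le = split₃ k m₁ u m₂ v (trans hd (trans (cong (_+ 1) et) (+-assoc (2 * k) 1 1))) et hs ht le
    where et = solve-t t (2 * k + 1) 1 hn′ (t₃ k)
  go α₃ 2 hd hn′ hn le = ⊥-elim (parity-clash (suc t) (2 * k + 1) (even-t t) (r₃ k) hn′)

rotate : ℕ × ℕ × ℕ × ℕ → ℕ × ℕ × ℕ × ℕ
rotate (w , x , y , z) = (x , y , z , w)

IsRotation : ℕ × ℕ × ℕ × ℕ → ℕ × ℕ × ℕ × ℕ → Set
IsRotation p q = p ≡ q ⊎ rotate p ≡ q ⊎ rotate (rotate p) ≡ q ⊎ rotate (rotate (rotate p)) ≡ q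

private
  Ordered : ℕ → ℕ → ℕ → ℕ → Set
  Ordered a b m u = (a ≡ m × b ≡ m + u) ⊎ (a ≡ m + u × b ≡ m)

  order-pair : ∀ a b → ∃ λ m → ∃ λ u → Ordered a b m u
  order-pair a b with ≤-total a b
  ... | inj₁ le = a , b ∸ a , inj₁ (refl , sym (m+[n∸m]≡n le))
  ... | inj₂ le = b , a ∸ b , inj₂ (sym (m+[n∸m]≡n le) , refl)

  ordered-sum : ∀ {a b m u} → Ordered a b m u → a + b ≡ 2 * m + u
  ordered-sum {m = m} {u} (inj₁ (refl , refl)) = ring m u
    where
    ring : ∀ m u → m + (m + u) ≡ 2 * m + u
    ring = solve-∀
  ordered-sum {m = m} {u} (inj₂ (refl , refl)) = ring m u
    where
    ring : ∀ m u → m + u + m ≡ 2 * m + u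
    ring = solve-∀

  -- `value` sees an opposite pair only through its sum and product, and treats both pairs alike;
  -- this also yields `value-rotate` and `value-flip₂`.
  value-flip₁ : ∀ w x y z → value w x y z ≡ value y x w z
  value-flip₁ = ring
    where
    ring : ∀ w x y z → w * y * (x + z + 3) + x * z * (w + y + 3) + 2 * (w + y) * (x + z)
         ≡ y * w * (x + z + 3) + x * z * (y + w + 3) + 2 * (y + w) * (x + z)
    ring = solve-∀

value-rotate : ∀ w x y z → value w x y z ≡ value x y z w
value-rotate = ring
  where
  ring : ∀ w x y z → w * y * (x + z + 3) + x * z * (w + y + 3) + 2 * (w + y) * (x + z)
       ≡ x * z * (y + w + 3) + y * w * (x + z + 3) + 2 * (x + z) * (y + w)
  ring = solve-∀

private
  value-flip₂ : ∀ w x y z → value w x y z ≡ value w z y x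
  value-flip₂ = ring
    where
    ring : ∀ w x y z → w * y * (x + z + 3) + x * z * (w + y + 3) + 2 * (w + y) * (x + z)
         ≡ w * y * (z + x + 3) + z * x * (w + y + 3) + 2 * (w + y) * (z + x)
    ring = solve-∀

  value-ordered : ∀ {w x y z m₁ u m₂ v} → Ordered w y m₁ u → Ordered x z m₂ v →
                  value w x y z ≡ value m₁ m₂ (m₁ + u) (m₂ + v)
  value-ordered (inj₁ (refl , refl)) (inj₁ (refl , refl)) = refl
  value-ordered {w} {x} {y} {z} (inj₁ (refl , refl)) (inj₂ (refl , refl)) = value-flip₂ w x y z
  value-ordered {w} {x} {y} {z} (inj₂ (refl , refl)) (inj₁ (refl , refl)) = value-flip₁ w x y z
  value-ordered {w} {x} {y} {z} (inj₂ (refl , refl)) (inj₂ (refl , refl)) =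
    trans (value-flip₁ w x y z) (value-flip₂ y x w z)

  ordered-0 : ∀ {a b m} → Ordered a b m 0 → a ≡ m × b ≡ m
  ordered-0 (inj₁ (p , q)) = p , trans q (0+ _)
  ordered-0 (inj₂ (p , q)) = trans p (0+ _) , q

  ordered-1 : ∀ {a b m} → Ordered a b m 1 → (a ≡ m × b ≡ suc m) ⊎ (a ≡ suc m × b ≡ m)
  ordered-1 (inj₁ (p , q)) = inj₁ (p , trans q (+-comm _ 1))
  ordered-1 (inj₂ (p , q)) = inj₂ (trans p (+-comm _ 1) , q)

  -- Swapping the roles of the two pairs of opposite segments is a rotation by one step.
  reassemble : ∀ k α {w x y z m₁ u m₂ v} → Ordered w y m₁ u → Ordered x z m₂ v →
    Split k α m₁ u m₂ v ⊎ Split k α m₂ v m₁ u → IsRotation (w , x , y , z) (cpaths k α)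
  reassemble k α₀ o₁ o₂ (inj₁ refl) with ordered-0 o₁ | ordered-0 o₂
  ... | refl , refl | refl , refl = inj₁ refl
  reassemble k α₀ o₁ o₂ (inj₂ refl) with ordered-0 o₁ | ordered-0 o₂
  ... | refl , refl | refl , refl = inj₁ refl
  reassemble k α₁ o₁ o₂ (inj₁ refl) with ordered-1 o₁ | ordered-0 o₂
  ... | inj₁ (refl , refl) | refl , refl = inj₂ (inj₂ (inj₁ refl))
  ... | inj₂ (refl , refl) | refl , refl = inj₁ refl
  reassemble k α₁ o₁ o₂ (inj₂ refl) with ordered-0 o₁ | ordered-1 o₂
  ... | refl , refl | inj₁ (refl , refl) = inj₂ (inj₂ (inj₂ refl))
  ... | refl , refl | inj₂ (refl , refl) = inj₂ (inj₁ refl)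
  reassemble k α₂ o₁ o₂ (inj₁ refl) with ordered-0 o₁ | ordered-0 o₂
  ... | refl , refl | refl , refl = inj₁ refl
  reassemble k α₂ o₁ o₂ (inj₂ refl) with ordered-0 o₁ | ordered-0 o₂
  ... | refl , refl | refl , refl = inj₂ (inj₁ refl)
  reassemble k α₃ o₁ o₂ (inj₁ refl) with ordered-0 o₁ | ordered-1 o₂
  ... | refl , refl | inj₁ (refl , refl) = inj₂ (inj₂ (inj₁ refl))
  ... | refl , refl | inj₂ (refl , refl) = inj₁ refl
  reassemble k α₃ o₁ o₂ (inj₂ refl) with ordered-1 o₁ | ordered-0 o₂
  ... | inj₁ (refl , refl) | refl , refl = inj₂ (inj₁ refl)
  ... | inj₂ (refl , refl) | refl , refl = inj₂ (inj₂ (inj₂ refl))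

optimal : ∀ k α w x y z → w + x + y + z ≡ 4 * k + toℕ α → value′ (cpaths k α) ≤ value w x y z →
          IsRotation (w , x , y , z) (cpaths k α)
optimal k α w x y z hn le with order-pair w y | order-pair x z
... | m₁ , u , o₁ | m₂ , v , o₂ = reassemble k α o₁ o₂ (by-size (≤-total (x + z) (w + y)))
  where
  s≡ = ordered-sum o₁
  t≡ = ordered-sum o₂
  regroup : ∀ w x y z → w + y + (x + z) ≡ w + x + y + z
  regroup = solve-∀
  le′ : value′ (cpaths k α) ≤ value m₁ m₂ (m₁ + u) (m₂ + v)
  le′ = ≤-trans le (≤-reflexive (value-ordered o₁ o₂))
  -- The pair with the larger sum goes first, so that the difference d is a natural number.
  by-size : (x + z) ≤ (w + y) ⊎ (w + y) ≤ (x + z) → Split k α m₁ u m₂ v ⊎ Split k α m₂ v m₁ u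
  by-size (inj₁ h) = inj₁ (optimal-split k α m₁ u m₂ v _ s≡ t≡ d≡ n≡
      (deficit-bound k m₁ u m₂ v _ s≡ t≡ d≡ α n≡ le′))
    where
    d≡ = sym (m+[n∸m]≡n h)
    n≡ = trans (regroup w x y z) hn
  by-size (inj₂ h) = inj₂ (optimal-split k α m₂ v m₁ u _ t≡ s≡ d≡ n≡
      (deficit-bound k m₂ v m₁ u _ t≡ s≡ d≡ α n≡ (≤-trans le′ (≤-reflexive
        (trans (value-rotate m₁ m₂ (m₁ + u) (m₂ + v)) (value-flip₂ m₂ (m₁ + u) (m₂ + v) m₁))))))
    where
    d≡ = sym (m+[n∸m]≡n h)
    n≡ = trans (+-comm (x + z) (w + y)) (trans (regroup w x y z) hn)

Positive : ℕ × ℕ × ℕ × ℕ → Set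
Positive (w , x , y , z) = (1 ≤ w × 1 ≤ x) × (1 ≤ y × 1 ≤ z)

cpaths-positive : ∀ {k} → 1 ≤ k → ∀ α → Positive (cpaths k α)
cpaths-positive h α₀ = (h , h) , (h , h)
cpaths-positive h α₁ = (s≤s z≤n , h) , (h , h)
cpaths-positive h α₂ = (s≤s z≤n , h) , (s≤s z≤n , h)
cpaths-positive h α₃ = (s≤s z≤n , s≤s z≤n) , (s≤s z≤n , h)

rotation-positive : ∀ {p q} → IsRotation p q → Positive q → Positive p
rotation-positive (inj₁ refl) h = h
rotation-positive (inj₂ (inj₁ refl)) ((x , y) , (z , w)) = (w , x) , (y , z)
rotation-positive (inj₂ (inj₂ (inj₁ refl))) ((y , z) , (w , x)) = (w , x) , (y , z)
rotation-positive (inj₂ (inj₂ (inj₂ refl))) ((z , w) , (x , y)) = (w , x) , (y , z)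

cpaths-sum : ∀ k α → let w , x , y , z = cpaths k α in w + x + y + z ≡ 4 * k + toℕ α
cpaths-sum k α₀ = ring k
  where
  ring : ∀ k → k + k + k + k ≡ 4 * k + 0
  ring = solve-∀
cpaths-sum k α₁ = ring k
  where
  ring : ∀ k → suc k + k + k + k ≡ 4 * k + 1
  ring = solve-∀
cpaths-sum k α₂ = ring k
  where
  ring : ∀ k → suc k + k + suc k + k ≡ 4 * k + 2
  ring = solve-∀
cpaths-sum k α₃ = ring k
  where
  ring : ∀ k → suc k + suc k + suc k + k ≡ 4 * k + 3
  ring = solve-∀

-- Rotations

module _ {m : ℕ} (C : CyclicOrder m) where
  open CyclicOrder C
  private n = suc m

  vtx-cong : ∀ {i j} → i % n ≡ j % n → vtx i ≡ vtx j
  vtx-cong {i} {j} h = trans (sym (vtx-% i)) (trans (cong vtx h) (vtx-% j))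

  pos-vtx-% : ∀ i → pos (vtx i) ≡ i % n
  pos-vtx-% i = trans (cong pos (sym (vtx-% i))) (pos-vtx (m%n<n i n))

  pos⇒vtx : ∀ {v i} → pos v ≡ i % n → v ≡ vtx i
  pos⇒vtx {v} {i} h = trans (sym (vtx-pos v)) (trans (cong vtx h) (vtx-% i))

  vtx-suc : ∀ {i j} → vtx i ≡ vtx j → vtx (suc i) ≡ vtx (suc j)
  vtx-suc {i} {j} h = vtx-cong (trans (%-distribˡ-+ 1 i n)
    (trans (cong (λ k → (1 % n + k) % n) (inj h)) (sym (%-distribˡ-+ 1 j n))))

  shift : ∀ e → e ≤ n → CyclicOrder m
  shift e e≤n = record
    { vtx    = λ i → vtx (e + i)
    ; period = λ i → trans (cong vtx (swap₃ e n i)) (period (e + i))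
    -- Going on by n - e positions undoes the offset e up to a full period.
    ; surj   = λ v → (n ∸ e) + proj₁ (surj v) , trans (cong vtx (back (proj₁ (surj v)))) (trans (period _) (proj₂ (surj v)))
    -- The offset e is cancelled modulo n by adding n - e to both positions.
    ; inj    = λ {i} {j} h → trans (sym ([m+n]%n≡m%n i n)) (trans (add h) ([m+n]%n≡m%n j n))
    }
    where
    swap₃ : ∀ a b c → a + (b + c) ≡ b + (a + c)
    swap₃ = solve-∀
    back : ∀ i → e + ((n ∸ e) + i) ≡ n + i
    back i = trans (sym (+-assoc e (n ∸ e) i)) (cong (_+ i) (m+[n∸m]≡n e≤n))
    add : ∀ {i j} → vtx (e + i) ≡ vtx (e + j) → (i + n) % n ≡ (j + n) % n
    add {i} {j} h = trans (cong (_% n) (sym (regroup i)))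
      (trans (%-distribˡ-+ (n ∸ e) (e + i) n)
      (trans (cong (λ k → ((n ∸ e) % n + k) % n) (inj h))
      (trans (sym (%-distribˡ-+ (n ∸ e) (e + j) n)) (cong (_% n) (regroup j)))))
      where
      regroup : ∀ i → (n ∸ e) + (e + i) ≡ i + n
      regroup i = trans (swap₃ (n ∸ e) e i) (trans (back i) (+-comm n i))

  Joins : ℕ → ℕ → Fin n → Fin n → Set
  Joins i j u v = (u ≡ vtx i × v ≡ vtx j) ⊎ (v ≡ vtx i × u ≡ vtx j)

  -- Cycle and chords as a relation, free of the order and orientation in which edges are stored;
  -- rotations and isomorphisms act on this form.
  Adjacency : Graph n → ℕ → ℕ → ℕ → ℕ → Set
  Adjacency G a b c d = ∀ u v → Adj G u v ⇔ ((∃ λ i → Joins i (suc i) u v) ⊎ Joins a b u v ⊎ Joins c d u v)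

  -- Each vertex goes to its position in the cyclic order. The closing case of `TypeAAdj` is the
  -- step from position m to position 0.
  typeA⇒IsoTo : ∀ {G w x y z} → Adjacency G 0 (w + x) w (w + x + y) → IsoTo G (TypeAAdj n (w , x , y , z))
  typeA⇒IsoTo {G} {w} {x} {y} {z} adj =
    mk↔ₛ′ to (λ p → vtx (toℕ p)) to-from from-to ,
    λ u v → mk⇔ (λ e → encode u v (Equivalence.to (adj u v) e)) (λ t → Equivalence.from (adj u v) (decode u v t))
    where
    to : Fin n → Fin n
    to v = fromℕ< (pos< v)
    toℕ-to : ∀ v → toℕ (to v) ≡ pos v
    toℕ-to v = Finₚ.toℕ-fromℕ< (pos< v)
    to-from : ∀ p → to (vtx (toℕ p)) ≡ p
    to-from p = Finₚ.toℕ-injective (trans (toℕ-to _) (pos-vtx (Finₚ.toℕ<n p)))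
    from-to : ∀ v → vtx (toℕ (to v)) ≡ v
    from-to v = trans (cong vtx (toℕ-to v)) (vtx-pos v)
    at : ∀ {v i} → v ≡ vtx i → toℕ (to v) ≡ i % n
    at {v} {i} h = trans (toℕ-to v) (trans (cong pos h) (pos-vtx-% i))
    at⁻ : ∀ {v i} → toℕ (to v) ≡ i % n → v ≡ vtx i
    at⁻ {v} h = pos⇒vtx (trans (sym (toℕ-to v)) h)
    Cyc : Fin n → Fin n → Set
    Cyc a b = (toℕ b ≡ suc (toℕ a)) ⊎ ((toℕ a ≡ m) × (toℕ b ≡ 0))
    cyc : ∀ {u v i} → u ≡ vtx i → v ≡ vtx (suc i) → Cyc (to u) (to v)
    cyc {u} {v} {i} p q with m≤n⇒m<n∨m≡n (pos< u)
    ... | inj₁ l = inj₁ (trans (at v≡) (trans (m<n⇒m%n≡m l) (cong suc (sym (toℕ-to u)))))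
      where v≡ = trans q (vtx-suc (sym (trans (vtx-pos u) p)))
    ... | inj₂ e = inj₂ (trans (toℕ-to u) (suc-injective e) , trans (at v≡) (trans (cong (_% n) e) (n%n≡0 n)))
      where v≡ = trans q (vtx-suc (sym (trans (vtx-pos u) p)))
    cyc⁻ : ∀ {u v} → Cyc (to u) (to v) → u ≡ vtx (pos u) × v ≡ vtx (suc (pos u))
    cyc⁻ {u} {v} (inj₁ h) = sym (vtx-pos u) ,
      trans (sym (vtx-pos v)) (cong vtx (trans (sym (toℕ-to v)) (trans h (cong suc (toℕ-to u)))))
    cyc⁻ {u} {v} (inj₂ (g , h)) = sym (vtx-pos u) ,
      pos⇒vtx (trans (sym (toℕ-to v)) (trans h (sym (trans (cong (λ k → suc k % n) (trans (sym (toℕ-to u)) g)) (n%n≡0 n)))))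
    encode : ∀ u v → (∃ λ i → Joins i (suc i) u v) ⊎ Joins 0 (w + x) u v ⊎ Joins w (w + x + y) u v →
             TypeAAdj n (w , x , y , z) (to u) (to v)
    encode u v (inj₁ (i , inj₁ (p , q))) = inj₁ (cyc p q)
    encode u v (inj₁ (i , inj₂ (p , q))) = inj₂ (inj₁ (cyc p q))
    encode u v (inj₂ (inj₁ (inj₁ (p , q)))) = inj₂ (inj₂ (inj₁ (inj₁ (at p , at q))))
    encode u v (inj₂ (inj₁ (inj₂ (p , q)))) = inj₂ (inj₂ (inj₁ (inj₂ (at p , at q))))
    encode u v (inj₂ (inj₂ (inj₁ (p , q)))) = inj₂ (inj₂ (inj₂ (inj₁ (at p , at q))))
    encode u v (inj₂ (inj₂ (inj₂ (p , q)))) = inj₂ (inj₂ (inj₂ (inj₂ (at p , at q))))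
    decode : ∀ u v → TypeAAdj n (w , x , y , z) (to u) (to v) →
             (∃ λ i → Joins i (suc i) u v) ⊎ Joins 0 (w + x) u v ⊎ Joins w (w + x + y) u v
    decode u v (inj₁ h) = inj₁ (pos u , inj₁ (cyc⁻ h))
    decode u v (inj₂ (inj₁ h)) = inj₁ (pos v , inj₂ (cyc⁻ h))
    decode u v (inj₂ (inj₂ (inj₁ (inj₁ (p , q))))) = inj₂ (inj₁ (inj₁ (at⁻ p , at⁻ q)))
    decode u v (inj₂ (inj₂ (inj₁ (inj₂ (p , q))))) = inj₂ (inj₁ (inj₂ (at⁻ p , at⁻ q)))
    decode u v (inj₂ (inj₂ (inj₂ (inj₁ (p , q))))) = inj₂ (inj₂ (inj₁ (at⁻ p , at⁻ q)))
    decode u v (inj₂ (inj₂ (inj₂ (inj₂ (p , q))))) = inj₂ (inj₂ (inj₂ (at⁻ p , at⁻ q)))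

module _ {m : ℕ} (C : CyclicOrder m) where
  open CyclicOrder C
  private n = suc m

  -- a′, b′, c′, d′ are the chord ends counted from e.
  shift-adjacency : ∀ {G a b c d a′ b′ c′ d′} e (e≤n : e ≤ n) → vtx (e + a′) ≡ vtx a → vtx (e + b′) ≡ vtx b →
    vtx (e + c′) ≡ vtx c → vtx (e + d′) ≡ vtx d →
    Adjacency C G a b c d → Adjacency (shift C e e≤n) G a′ b′ c′ d′
  shift-adjacency {G} {a} {b} {c} {d} {a′} {b′} {c′} {d′} e e≤n pa pb pc pd adj u v =
    mk⇔ (λ h → fwd (Equivalence.to (adj u v) h)) (λ h → Equivalence.from (adj u v) (bwd h))
    where
    convert : ∀ {i j i′ j′} → vtx i ≡ vtx i′ → vtx j ≡ vtx j′ → Joins C i j u v → Joins C i′ j′ u v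
    convert p q (inj₁ (r , s)) = inj₁ (trans r p , trans s q)
    convert p q (inj₂ (r , s)) = inj₂ (trans r p , trans s q)
    back : ∀ i → vtx i ≡ vtx (e + ((n ∸ e) + i))
    back i = sym (trans (cong vtx (trans (sym (+-assoc e (n ∸ e) i)) (cong (_+ i) (m+[n∸m]≡n e≤n)))) (period i))
    fwd : (∃ λ i → Joins C i (suc i) u v) ⊎ Joins C a b u v ⊎ Joins C c d u v →
          (∃ λ i → Joins (shift C e e≤n) i (suc i) u v) ⊎ Joins (shift C e e≤n) a′ b′ u v ⊎ Joins (shift C e e≤n) c′ d′ u v
    fwd (inj₁ (i , J)) = inj₁ ((n ∸ e) + i , convert (back i) (trans (back (suc i))
      (cong (λ k → vtx (e + k)) (+-suc (n ∸ e) i))) J)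
    fwd (inj₂ (inj₁ J)) = inj₂ (inj₁ (convert (sym pa) (sym pb) J))
    fwd (inj₂ (inj₂ J)) = inj₂ (inj₂ (convert (sym pc) (sym pd) J))
    bwd : (∃ λ i → Joins (shift C e e≤n) i (suc i) u v) ⊎ Joins (shift C e e≤n) a′ b′ u v ⊎ Joins (shift C e e≤n) c′ d′ u v →
          (∃ λ i → Joins C i (suc i) u v) ⊎ Joins C a b u v ⊎ Joins C c d u v
    bwd (inj₁ (i , J)) = inj₁ (e + i , convert refl (cong vtx (+-suc e i)) J)
    bwd (inj₂ (inj₁ J)) = inj₂ (inj₁ (convert pa pb J))
    bwd (inj₂ (inj₂ J)) = inj₂ (inj₂ (convert pc pd J))

  -- After a rotation by the first segment the second chord starts at 0, and the first chord is met
  -- at its other end; hence the exchange with one reversal.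
  swap-adjacency : ∀ {G a b c d} → Adjacency C G a b c d → Adjacency C G c d b a
  swap-adjacency adj u v = mk⇔ (λ h → fwd (Equivalence.to (adj u v) h)) (λ h → Equivalence.from (adj u v) (bwd h))
    where
    flip : ∀ {i j} → Joins C i j u v → Joins C j i u v
    flip (inj₁ (p , q)) = inj₂ (q , p)
    flip (inj₂ (p , q)) = inj₁ (q , p)
    fwd : ∀ {X : Set} {a b c d} → X ⊎ Joins C a b u v ⊎ Joins C c d u v → X ⊎ Joins C c d u v ⊎ Joins C b a u v
    fwd (inj₁ x) = inj₁ x
    fwd (inj₂ (inj₁ J)) = inj₂ (inj₂ (flip J))
    fwd (inj₂ (inj₂ J)) = inj₂ (inj₁ J)
    bwd : ∀ {X : Set} {a b c d} → X ⊎ Joins C c d u v ⊎ Joins C b a u v → X ⊎ Joins C a b u v ⊎ Joins C c d u v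
    bwd (inj₁ x) = inj₁ x
    bwd (inj₂ (inj₁ J)) = inj₂ (inj₂ J)
    bwd (inj₂ (inj₂ J)) = inj₂ (inj₁ (flip J))

TypeA : ∀ {m} → Graph (suc m) → ℕ × ℕ × ℕ × ℕ → Set
TypeA {m} G (w , x , y , z) = ∃ λ (C : CyclicOrder m) → w + x + y + z ≡ suc m × Adjacency C G 0 (w + x) w (w + x + y)

TypeA-rotate : ∀ {m} {G : Graph (suc m)} q → TypeA G q → TypeA G (rotate q)
TypeA-rotate {m} {G} (w , x , y , z) (C , sum , adj) =
  shift C w w≤n , trans (cyclic w x y z) sum ,
  shift-adjacency C {G} {w} {w + x + y} {w + x} {0} w w≤n (cong vtx (+-identityʳ w)) (cong vtx (sym (+-assoc w x y))) refl
    -- The old starting point is reached again after x + y + z further positions, at n.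
    (trans (cong vtx (trans (assoc₄ w x y z) (trans sum (sym (+-identityʳ _))))) (period 0))
    (swap-adjacency C {G} adj)
  where
  open CyclicOrder C
  cyclic : ∀ w x y z → x + y + z + w ≡ w + x + y + z
  cyclic = solve-∀
  assoc₄ : ∀ w x y z → w + (x + y + z) ≡ w + x + y + z
  assoc₄ = solve-∀
  w≤n : w ≤ suc m
  w≤n = ≤-trans (m≤m+n w (x + y + z)) (≤-reflexive (trans (assoc₄ w x y z) sum))

TypeA-IsRotation : ∀ {m} (G : Graph (suc m)) p q → IsRotation p q → TypeA G p → TypeA G q
TypeA-IsRotation G p q (inj₁ refl) = id
TypeA-IsRotation G p q (inj₂ (inj₁ refl)) = TypeA-rotate {G = G} p
TypeA-IsRotation G p q (inj₂ (inj₂ (inj₁ refl))) = TypeA-rotate {G = G} (rotate p) ∘ TypeA-rotate {G = G} p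
TypeA-IsRotation G p q (inj₂ (inj₂ (inj₂ refl))) =
  TypeA-rotate {G = G} (rotate (rotate p)) ∘ TypeA-rotate {G = G} (rotate p) ∘ TypeA-rotate {G = G} p

-- Hamiltonian graphs with two chords

module _ {n : ℕ} where

  mk-< : {u v : Fin n} → u Fin.< v → mk u v ≡ (u , v)
  mk-< h rewrite <⇒<ᵇ≡true h = refl

  mk-> : {u v : Fin n} → v Fin.< u → mk u v ≡ (v , u)
  mk-> h rewrite ≤⇒<ᵇ≡false (<⇒≤ h) = refl

  mk-sym : (u v : Fin n) → mk u v ≡ mk v u
  mk-sym u v with <-cmp (toℕ u) (toℕ v)
  ... | tri< h _ _ = trans (mk-< h) (sym (mk-> h))
  ... | tri≈ _ e _ rewrite Finₚ.toℕ-injective e = refl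
  ... | tri> _ _ h = trans (mk-> h) (sym (mk-< h))

  mk-ordered : {u v : Fin n} → u ≢ v → proj₁ (mk u v) Fin.< proj₂ (mk u v)
  mk-ordered {u} {v} ne with <-cmp (toℕ u) (toℕ v)
  ... | tri< h _ _ rewrite mk-< h = h
  ... | tri≈ _ e _ = ⊥-elim (ne (Finₚ.toℕ-injective e))
  ... | tri> _ _ h rewrite mk-> h = h

  mk-injective : {u v u′ v′ : Fin n} → mk u v ≡ mk u′ v′ → (u ≡ u′ × v ≡ v′) ⊎ (u ≡ v′ × v ≡ u′)
  mk-injective {u} {v} {u′} {v′} h with mk-cases u v | mk-cases u′ v′
  ... | inj₁ p | inj₁ q with trans (sym p) (trans h q)
  ...   | refl = inj₁ (refl , refl)
  mk-injective h | inj₁ p | inj₂ q with trans (sym p) (trans h q)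
  ...   | refl = inj₂ (refl , refl)
  mk-injective h | inj₂ p | inj₁ q with trans (sym p) (trans h q)
  ...   | refl = inj₂ (refl , refl)
  mk-injective h | inj₂ p | inj₂ q with trans (sym p) (trans h q)
  ...   | refl = inj₁ (refl , refl)

  Adj⇒mk∈ : (G : Graph n) {u v : Fin n} → Adj G u v → mk u v ∈ edges G
  Adj⇒mk∈ G (inj₁ e) = subst (_∈ edges G) (sym (mk-< (All.lookup (ordered G) e))) e
  Adj⇒mk∈ G (inj₂ e) = subst (_∈ edges G) (sym (mk-> (All.lookup (ordered G) e))) e

  mk∈⇒Adj : (G : Graph n) {u v : Fin n} → mk u v ∈ edges G → Adj G u v
  mk∈⇒Adj G {u} {v} e with mk-cases u v
  ... | inj₁ p = inj₁ (subst (_∈ edges G) p e)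
  ... | inj₂ p = inj₂ (subst (_∈ edges G) p e)

  Adj-sym : (G : Graph n) {u v : Fin n} → Adj G u v → Adj G v u
  Adj-sym G = Sum.swap

-- Both the count and the adjacency relation are read off this form; the relative position of the
-- chords is left open.
record Presented {m : ℕ} (G : Graph (suc m)) : Set where
  field
    order : CyclicOrder m
  open CyclicOrder order public
  field
    a b c d : ℕ
    a< : a < suc m
    b< : b < suc m
    c< : c < suc m
    d< : d < suc m
    edges↭ : edges G ↭ mk (vtx a) (vtx b) ∷ mk (vtx c) (vtx d) ∷ map cycleEdge (downFrom (suc m))

module _ {m : ℕ} {G : Graph (suc m)} where

  adjacency : (P : Presented G) → let open Presented P in Adjacency order G a b c d
  adjacency P u v = mk⇔ to from
    where
    open Presented P
    n = suc m
    E = mk (vtx a) (vtx b) ∷ mk (vtx c) (vtx d) ∷ map cycleEdge (downFrom n)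
    X = (∃ λ i → Joins order i (suc i) u v) ⊎ Joins order a b u v ⊎ Joins order c d u v
    to : Adj G u v → X
    to h = locate (Permₚ.∈-resp-↭ edges↭ (Adj⇒mk∈ G h))
      where
      joins′ : ∀ {p q} → mk u v ≡ mk (vtx p) (vtx q) → Joins order p q u v
      joins′ e with mk-injective e
      ... | inj₁ (r , s) = inj₁ (r , s)
      ... | inj₂ (r , s) = inj₂ (s , r)
      locate : mk u v ∈ E → X
      locate (here e)          = inj₂ (inj₁ (joins′ e))
      locate (there (here e))  = inj₂ (inj₂ (joins′ e))
      locate (there (there k)) with ∈-map⁻ cycleEdge k
      ... | i , _ , e = inj₁ (i , joins′ e)
    from′ : ∀ {p q} → mk (vtx p) (vtx q) ∈ E → Joins order p q u v → Adj G u v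
    from′ k (inj₁ (refl , refl)) = mk∈⇒Adj G (Permₚ.∈-resp-↭ (↭-sym edges↭) k)
    from′ k (inj₂ (refl , refl)) = Adj-sym G (mk∈⇒Adj G (Permₚ.∈-resp-↭ (↭-sym edges↭) k))
    from : X → Adj G u v
    -- The index i is arbitrary, while the list holds the cycle edges below n; so i is reduced
    -- modulo n.
    from (inj₁ (i , J)) = from′ {i % n} {suc (i % n)}
      (there (there (∈-map⁺ cycleEdge (∈-downFrom⁺ (m%n<n i n))))) (reduce J)
      where
      e : vtx i ≡ vtx (i % n)
      e = sym (vtx-% i)
      reduce : Joins order i (suc i) u v → Joins order (i % n) (suc (i % n)) u v
      reduce (inj₁ (r , s)) = inj₁ (trans r e , trans s (vtx-suc order e))
      reduce (inj₂ (r , s)) = inj₂ (trans r e , trans s (vtx-suc order e))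
    from (inj₂ (inj₁ J)) = from′ (here refl) J
    from (inj₂ (inj₂ J)) = from′ (there (here refl)) J

  count : Graph (suc m) → ℕ
  count H = cnt (connected? (suc m)) (edges H)

  count-presented : (P : Presented G) → let open Presented P
                                            module K = Chords order a b c d (<⇒≤ a<) (<⇒≤ b<) (<⇒≤ c<) (<⇒≤ d<) in
    count G ≡ value (occ c₀₀ K.arcs) (occ c₁₀ K.arcs) (occ c₁₁ K.arcs) (occ c₀₁ K.arcs) + 4 * suc (suc m)
  count-presented P = trans (cnt-↭ connected?-resp-↭ edges↭) K.cnt-connected
    where
    open Presented P
    module K = Chords order a b c d (<⇒≤ a<) (<⇒≤ b<) (<⇒≤ c<) (<⇒≤ d<)

  record Sorted (P : Presented G) : Set where
    open Presented P
    field
      a≤b : a ≤ b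
      c≤d : c ≤ d
      a≤c : a ≤ c

  -- Exchanging ends and chords leaves three positions to distinguish: crossing, nested and
  -- disjoint.
  sort : Presented G → ∃ Sorted
  sort P = let Q , a≤b , c≤d = chords P in fix Q a≤b c≤d
    where
    open Presented
    swap₁ : Presented G → Presented G
    swap₁ P = record { order = order P ; a = b P ; b = a P ; c = c P ; d = d P ; a< = b< P ; b< = a< P ; c< = c< P ; d< = d< P
      ; edges↭ = subst (λ e → edges G ↭ e ∷ mk (vtx P (c P)) (vtx P (d P)) ∷ map (cycleEdge P) (downFrom (suc m))) (mk-sym _ _) (edges↭ P) }
    swap₂ : Presented G → Presented G
    swap₂ P = record { order = order P ; a = c P ; b = d P ; c = a P ; d = b P ; a< = c< P ; b< = d< P ; c< = a< P ; d< = b< P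
      ; edges↭ = ↭-trans (edges↭ P) (Perm.swap _ _ ↭-refl) }
    first : (P : Presented G) → ∃ λ Q → a Q ≤ b Q × c Q ≡ c P × d Q ≡ d P
    first P with ≤-total (a P) (b P)
    ... | inj₁ h = P , h , refl , refl
    ... | inj₂ h = swap₁ P , h , refl , refl
    chords : (P : Presented G) → ∃ λ Q → a Q ≤ b Q × c Q ≤ d Q
    chords P with first P
    ... | Q , h , _ with first (swap₂ Q)
    ...   | R , k , e , f = R , k , subst₂ _≤_ (sym e) (sym f) h
    fix : (Q : Presented G) → a Q ≤ b Q → c Q ≤ d Q → ∃ Sorted
    fix Q h k with ≤-total (a Q) (c Q)
    ... | inj₁ l = Q , record { a≤b = h ; c≤d = k ; a≤c = l }
    ... | inj₂ l = swap₂ Q , record { a≤b = k ; c≤d = h ; a≤c = l }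

difference : ∀ {i j} → i ≤ j → ∃ λ e → j ≡ e + i
difference {i} {j} h = j ∸ i , sym (m∸n+n≡m h)

module _ {a b c d n w x y r : ℕ} where

  -- Class 00 is made of the last segment and the initial one, which are joined across position 0.
  crossing-occ : c ≡ w + a → b ≡ x + c → d ≡ y + b → n ≡ r + d → let cs = arcColours a b c d n in
    occ c₀₀ cs ≡ r + a × occ c₁₀ cs ≡ w × occ c₁₁ cs ≡ x × occ c₀₁ cs ≡ y
  crossing-occ refl refl refl refl =
    o c₀₀ , trans (o c₁₀) (+-identityʳ w) , trans (o c₁₁) (+-identityʳ x) , trans (o c₀₁) (+-identityʳ y)
    where o = occ-four (λ t₀ t₁ t₂ t₃ → t₀ xor t₂ , t₁ xor t₃) a w x y r

  -- The arc of the inner chord lies inside that of the outer one.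
  nested-occ : c ≡ w + a → d ≡ x + c → b ≡ y + d → n ≡ r + b → occ c₀₁ (arcColours a b c d n) ≡ 0
  nested-occ refl refl refl refl = occ-four (λ t₀ t₁ t₂ t₃ → t₀ xor t₃ , t₁ xor t₂) a w x y r c₀₁

  -- No cycle edge lies on both arcs.
  disjoint-occ : b ≡ w + a → c ≡ x + b → d ≡ y + c → n ≡ r + d → occ c₁₁ (arcColours a b c d n) ≡ 0
  disjoint-occ refl refl refl refl = occ-four (λ t₀ t₁ t₂ t₃ → t₀ xor t₁ , t₂ xor t₃) a w x y r c₁₁

colourCounts : List Colour → ℕ × ℕ × ℕ × ℕ
colourCounts cs = occ c₀₀ cs , occ c₁₀ cs , occ c₁₁ cs , occ c₀₁ cs

crossing-TypeA : ∀ {m} {G : Graph (suc m)} (P : Presented G) {w x y r} → let open Presented P in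
  c ≡ w + a → b ≡ x + c → d ≡ y + b → suc m ≡ r + d → TypeA G (colourCounts (arcColours a b c d (suc m)))
crossing-TypeA {m} {G} P {w} {x} {y} {r} ec eb ed en
  with crossing-occ {a} {b} {c} {d} {suc m} {w} {x} {y} {r} ec eb ed en
  where open Presented P
... | e₁ , e₂ , e₃ , e₄ rewrite e₁ | e₂ | e₃ | e₄ =
  -- Counted from the chord end a the segments are w, x, y, r + a, while the colour counts list the
  -- last of them first.
  TypeA-IsRotation G (w , x , y , r + a) (r + a , w , x , y) (inj₂ (inj₂ (inj₂ refl)))
    (shift order a (<⇒≤ a<) , trans (regroup w x y r a) (sym n≡) ,
     shift-adjacency order {G} a (<⇒≤ a<) (cong vtx (+-identityʳ a)) (cong vtx b≡) (cong vtx c≡) (cong vtx d≡) (adjacency P))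
  where
  open Presented P
  c≡ : a + w ≡ c
  c≡ = trans (+-comm a w) (sym ec)
  b≡ : a + (w + x) ≡ b
  b≡ = trans (sym (+-assoc a w x)) (trans (cong (_+ x) c≡) (trans (+-comm c x) (sym eb)))
  d≡ : a + (w + x + y) ≡ d
  d≡ = trans (sym (+-assoc a (w + x) y)) (trans (cong (_+ y) b≡) (trans (+-comm b y) (sym ed)))
  regroup : ∀ w x y r a → w + x + y + (r + a) ≡ r + (a + (w + x + y))
  regroup = solve-∀
  n≡ : suc m ≡ r + (a + (w + x + y))
  n≡ = trans en (cong (r +_) (sym d≡))

-- Nested chords leave class 01 empty and disjoint chords class 11, so positivity forces a crossing.
positive⇒TypeA : ∀ {m} {G : Graph (suc m)} (P : Presented G) → Sorted P → let open Presented P in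
  Positive (colourCounts (arcColours a b c d (suc m))) → TypeA G (colourCounts (arcColours a b c d (suc m)))
positive⇒TypeA {m} {G} P S (_ , (11>0 , 01>0)) = crossing (≤-total c b) (≤-total b d)
  where
  open Presented P
  open Sorted S
  crossing : c ≤ b ⊎ b ≤ c → b ≤ d ⊎ d ≤ b → TypeA G (colourCounts (arcColours a b c d (suc m)))
  crossing (inj₁ h) (inj₁ k) = crossing-TypeA P (proj₂ (difference a≤c)) (proj₂ (difference h))
    (proj₂ (difference k)) (proj₂ (difference (<⇒≤ d<)))
  crossing (inj₁ h) (inj₂ k) = ⊥-elim (>⇒≢ 01>0 (nested-occ {a} (proj₂ (difference a≤c)) (proj₂ (difference c≤d))
    (proj₂ (difference k)) (proj₂ (difference (<⇒≤ b<)))))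
  crossing (inj₂ h) _ = ⊥-elim (>⇒≢ 11>0 (disjoint-occ {a} (proj₂ (difference a≤b)) (proj₂ (difference h))
    (proj₂ (difference c≤d)) (proj₂ (difference (<⇒≤ d<)))))

-- The class sizes are determined first, for chords in any position. That they are a rotation of a
-- positive vector then shows that the chords cross.
count-max⇒TypeA : ∀ {m} {G : Graph (suc m)} k → 1 ≤ k → ∀ α → suc m ≡ 4 * k + toℕ α → Presented G →
  value′ (cpaths k α) + 4 * suc (suc m) ≤ cnt (connected? (suc m)) (edges G) → TypeA G (cpaths k α)
count-max⇒TypeA {m} {G} k 1≤k α en P₀ le = TypeA-IsRotation G _ (cpaths k α) rot
    (positive⇒TypeA P S (rotation-positive rot (cpaths-positive 1≤k α)))
  where
  P = proj₁ (sort {G = G} P₀)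
  S = proj₂ (sort {G = G} P₀)
  open Presented P
  cs = arcColours a b c d (suc m)
  rot : IsRotation (colourCounts cs) (cpaths k α)
  rot = optimal k α _ _ _ _
    (trans (occ-total cs) (trans (trans (length-map _ (downFrom (suc m))) (length-downFrom (suc m))) en))
    (+-cancelʳ-≤ (4 * suc (suc m)) _ _ (≤-trans le (≤-reflexive (count-presented {G = G} P))))

-- From a hamiltonian cycle to a cyclic order with two chords

nth : {A : Set} → A → List A → ℕ → A
nth d []       i       = d
nth d (x ∷ xs) zero    = x
nth d (x ∷ xs) (suc i) = nth d xs i

nth-beyond : {A : Set} (d : A) (xs : List A) {i : ℕ} → length xs ≤ i → nth d xs i ≡ d
nth-beyond d []       h       = refl
nth-beyond d (x ∷ xs) (s≤s h) = nth-beyond d xs h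

nth-snoc : {A : Set} (d : A) (xs : List A) (i : ℕ) → nth d (xs ++ [ d ]) i ≡ nth d xs i
nth-snoc d []       zero    = refl
nth-snoc d []       (suc i) = refl
nth-snoc d (x ∷ xs) zero    = refl
nth-snoc d (x ∷ xs) (suc i) = nth-snoc d xs i

nth-∈ : {A : Set} (d : A) (xs : List A) {i : ℕ} → i < length xs → nth d xs i ∈ xs
nth-∈ d (x ∷ xs) {zero}  h       = here refl
nth-∈ d (x ∷ xs) {suc i} (s≤s h) = there (nth-∈ d xs h)

∈-nth : {A : Set} (d : A) {xs : List A} {v : A} → v ∈ xs → ∃ λ i → i < length xs × nth d xs i ≡ v
∈-nth d (here refl) = 0 , s≤s z≤n , refl
∈-nth d (there m) with ∈-nth d m
... | i , h , e = suc i , s≤s h , e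

nth-injective : {A : Set} (d : A) {xs : List A} → Unique xs → ∀ {i j} → i < length xs → j < length xs →
                nth d xs i ≡ nth d xs j → i ≡ j
nth-injective d (h ∷ u) {zero}  {zero}  p q e = refl
nth-injective d {x ∷ xs} (h ∷ u) {zero}  {suc j} p (s≤s q) e = ⊥-elim (All.lookup h (nth-∈ d xs q) e)
nth-injective d {x ∷ xs} (h ∷ u) {suc i} {zero}  (s≤s p) q e = ⊥-elim (All.lookup h (nth-∈ d xs p) (sym e))
nth-injective d (h ∷ u) {suc i} {suc j} (s≤s p) (s≤s q) e = cong suc (nth-injective d u p q e)

consecAdj-nth : ∀ {n} (G : Graph n) d xs → consecAdj G xs → ∀ {i} → suc i < length xs →
                Adj G (nth d xs i) (nth d xs (suc i))
consecAdj-nth G d (x ∷ [])     _       (s≤s ())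
consecAdj-nth G d (x ∷ y ∷ xs) (e , _) {zero}  h       = e
consecAdj-nth G d (x ∷ y ∷ xs) (_ , k) {suc i} (s≤s h) = consecAdj-nth G d (y ∷ xs) k h

-- Serves to split the cycle edges off the edge list; what remains are the chords.
remove-sublist : {A : Set} {xs ys : List A} → Unique xs → All (_∈ ys) xs → ∃ λ zs → ys ↭ xs ++ zs
remove-sublist {ys = ys} [] [] = ys , ↭-refl
remove-sublist {xs = x ∷ xs} (x∉xs ∷ u) (m ∷ ms) with ∈-∃++ m
... | as , bs , refl with remove-sublist u (All.tabulate λ k → drop-x (All.lookup ms k) (All.lookup x∉xs k))
  where
  drop-x : ∀ {z} → z ∈ as ++ x ∷ bs → x ≢ z → z ∈ as ++ bs
  drop-x k ne with Permₚ.∈-resp-↭ (Permₚ.shift x as bs) k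
  ... | here e  = ⊥-elim (ne (sym e))
  ... | there l = l
... | zs , p = zs , ↭-trans (Permₚ.shift x as bs) (Perm.prep x p)

module _ {m : ℕ} (C : CyclicOrder m) (2≤m : 2 ≤ m) where
  open CyclicOrder C
  private n = suc m

  vtx-injective : ∀ {i j} → i < n → j < n → vtx i ≡ vtx j → i ≡ j
  vtx-injective p q e = trans (sym (m<n⇒m%n≡m p)) (trans (inj e) (m<n⇒m%n≡m q))

  vtx-n : vtx n ≡ vtx 0
  vtx-n = trans (cong vtx (sym (+-identityʳ n))) (period 0)

  vtx-suc-injective : ∀ {i j} → i < n → j < n → vtx i ≡ vtx (suc j) → (i ≡ suc j × suc j < n) ⊎ (i ≡ 0 × j ≡ m)
  vtx-suc-injective {i} {j} p q e with m≤n⇒m<n∨m≡n q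
  ... | inj₁ l    = inj₁ (vtx-injective p l e , l)
  ... | inj₂ refl = inj₂ (vtx-injective p (s≤s z≤n) (trans e vtx-n) , refl)

  -- Two cycle edges could also coincide with their ends exchanged; then each index is the cyclic
  -- successor of the other, which three or more vertices exclude.
  cycleEdge-injective : ∀ {i j} → i < n → j < n → cycleEdge i ≡ cycleEdge j → i ≡ j
  cycleEdge-injective {i} {j} p q e with mk-injective e
  ... | inj₁ (r , _) = vtx-injective p q r
  ... | inj₂ (r , s) with vtx-suc-injective p q r | vtx-suc-injective q p (sym s)
  ...   | inj₁ (refl , _)    | inj₁ (f , _)    = ⊥-elim (m≢1+m+n j {1} (trans f (cong suc (+-comm 1 j))))
  ...   | inj₁ (refl , _)    | inj₂ (refl , f) = ⊥-elim (<⇒≱ 2≤m (≤-reflexive (sym f)))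
  ...   | inj₂ (refl , refl) | inj₁ (f , _)    = ⊥-elim (<⇒≱ 2≤m (≤-reflexive f))
  ...   | inj₂ (refl , _)    | inj₂ (refl , _) = refl

  Unique-cycleEdges : Unique (map cycleEdge (downFrom n))
  Unique-cycleEdges = unique (downFrom n) (All.tabulate ∈-downFrom⁻) (downFrom⁺ n)
    where
    unique : ∀ L → All (_< n) L → Unique L → Unique (map cycleEdge L)
    unique []      _        _       = []
    unique (i ∷ L) (p ∷ ps) (h ∷ u) = Allₚ.map⁺ (All.tabulate λ k e →
      All.lookup h k (cycleEdge-injective p (All.lookup ps k) e)) ∷ unique L ps u

module _ {m : ℕ} (G : Graph (suc m)) where
  private n = suc m

  hamiltonianOrder : (c : List (Fin n)) → c ↭ allFin n → closesCycle G c →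
    ∃ λ (C : CyclicOrder m) → let open CyclicOrder C in ∀ {i} → i < n → Adj G (vtx i) (vtx (suc i))
  hamiltonianOrder (u ∷ vs) p cyc = record
    -- The default of `nth` is the first vertex of the cycle, so reading one place beyond the end
    -- gives the closing vertex.
    { vtx    = λ i → nth u c (i % n)
    ; period = λ i → cong (nth u c) (trans (cong (_% n) (+-comm n i)) ([m+n]%n≡m%n i n))
    ; surj   = λ v → let i , h , e = ∈-nth u (Permₚ.∈-resp-↭ (Perm.↭-sym p) (∈-allFin v)) in
                     i , trans (cong (nth u c) (m<n⇒m%n≡m (subst (i <_) len h))) e
    ; inj    = λ {i} {j} e → nth-injective u unique (below i) (below j) e
    } , adjacent
    where
    c = u ∷ vs
    len : length c ≡ n
    len = trans (Permₚ.↭-length p) (length-tabulate id)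
    unique : Unique c
    unique = Permₛₚ.Unique-resp-↭ (setoid (Fin n)) (Perm.↭⇒↭ₛ (Perm.↭-sym p)) (allFin⁺ n)
    below : ∀ i → i % n < length c
    below i = subst (i % n <_) (sym len) (m%n<n i n)
    adjacent : ∀ {i} → i < n → Adj G (nth u c (i % n)) (nth u c (suc i % n))
    adjacent {i} h = subst₂ (Adj G) (trans (nth-snoc u c i) (cong (nth u c) (sym (m<n⇒m%n≡m h))))
        (trans (nth-snoc u c (suc i)) (next (m≤n⇒m<n∨m≡n h)))
        (consecAdj-nth G u (c ++ [ u ]) cyc (subst (suc i <_) (sym (trans (length-++ c) (+-comm (length c) 1)))
          (s≤s (subst (i <_) (sym len) h))))
      where
      next : suc i < n ⊎ suc i ≡ n → nth u c (suc i) ≡ nth u c (suc i % n)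
      next (inj₁ l) = cong (nth u c) (sym (m<n⇒m%n≡m l))
      next (inj₂ e) = trans (nth-beyond u c (≤-reflexive (trans len (sym e))))
        (cong (nth u c) (sym (trans (cong (_% n) e) (n%n≡0 n))))

  -- The n cycle edges are distinct edges of G, so exactly two of the n + 2 edges remain.
  present : Hamiltonian G → ∣E∣ G ≡ n + 2 → Presented G
  present (3≤n , c , p , cyc) size = from-rest (remove-sublist (Unique-cycleEdges C (s≤s⁻¹ 3≤n))
      (Allₚ.map⁺ (All.tabulate λ k → Adj⇒mk∈ G (adjacent (∈-downFrom⁻ k)))))
    where
    C = proj₁ (hamiltonianOrder c p cyc)
    adjacent = proj₂ (hamiltonianOrder c p cyc)
    open CyclicOrder C
    ce = map cycleEdge (downFrom n)
    from-rest : (∃ λ zs → edges G ↭ ce ++ zs) → Presented G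
    from-rest (zs , q) = two zs q (+-cancelˡ-≡ n _ _ (trans (cong (_+ length zs) (sym len-ce))
      (trans (sym (length-++ ce)) (trans (sym (Permₚ.↭-length q)) size))))
      where
      len-ce : length ce ≡ n
      len-ce = trans (length-map cycleEdge (downFrom n)) (length-downFrom n)
      two : ∀ zs → edges G ↭ ce ++ zs → length zs ≡ 2 → Presented G
      two ((u , v) ∷ (u′ , v′) ∷ []) q refl = record
        { order = C ; a = pos u ; b = pos v ; c = pos u′ ; d = pos v′
        ; a< = pos< u ; b< = pos< v ; c< = pos< u′ ; d< = pos< v′
        ; edges↭ = ↭-trans q′ (Perm.↭-reflexive (cong₂ (λ e f → e ∷ f ∷ ce) (chord (here refl)) (chord (there (here refl)))))
        }
        where
        q′ : edges G ↭ (u , v) ∷ (u′ , v′) ∷ ce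
        q′ = ↭-trans q (Permₚ.++-comm ce _)
        -- A leftover edge is stored with increasing ends, so `mk` leaves it unchanged.
        chord : ∀ {x y} → (x , y) ∈ (u , v) ∷ (u′ , v′) ∷ ce → (x , y) ≡ mk (vtx (pos x)) (vtx (pos y))
        chord {x} {y} k = trans (sym (mk-< (All.lookup (ordered G) (Permₚ.∈-resp-↭ (↭-sym q′) k))))
          (cong₂ mk (sym (vtx-pos x)) (sym (vtx-pos y)))

-- The competing graph of type A

module _ (m : ℕ) where
  private n = suc m

  standardOrder : CyclicOrder m
  standardOrder = record
    { vtx    = λ i → fromℕ< (m%n<n i n)
    ; period = λ i → Finₚ.toℕ-injective (trans (toℕ-vtx (n + i))
        (trans (trans (cong (_% n) (+-comm n i)) ([m+n]%n≡m%n i n)) (sym (toℕ-vtx i))))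
    ; surj   = λ v → toℕ v , Finₚ.toℕ-injective (trans (toℕ-vtx (toℕ v)) (m<n⇒m%n≡m (Finₚ.toℕ<n v)))
    ; inj    = λ {i} {j} e → trans (sym (toℕ-vtx i)) (trans (cong toℕ e) (toℕ-vtx j))
    }
    where
    toℕ-vtx : ∀ i → toℕ (fromℕ< (m%n<n i n)) ≡ i % n
    toℕ-vtx i = Finₚ.toℕ-fromℕ< (m%n<n i n)

  open CyclicOrder standardOrder

  applyUpTo-tabulate : ∀ {A : Set} (f : ℕ → A) k → applyUpTo f k ≡ tabulate {n = k} (f ∘ toℕ)
  applyUpTo-tabulate f zero    = refl
  applyUpTo-tabulate f (suc k) = cong (f 0 ∷_) (applyUpTo-tabulate (f ∘ suc) k)

  standard-allFin : applyUpTo vtx n ≡ allFin n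
  standard-allFin = trans (applyUpTo-tabulate vtx n) (tabulate-cong λ v → Finₚ.toℕ-injective
    (trans (Finₚ.toℕ-fromℕ< (m%n<n (toℕ v) n)) (m<n⇒m%n≡m (Finₚ.toℕ<n v))))

  consecAdj-applyUpTo : (G : Graph n) (f : ℕ → Fin n) (k : ℕ) → (∀ {i} → suc i < k → Adj G (f i) (f (suc i))) →
                        consecAdj G (applyUpTo f k)
  consecAdj-applyUpTo G f 0             h = _
  consecAdj-applyUpTo G f 1             h = _
  consecAdj-applyUpTo G f (suc (suc k)) h = h (s≤s (s≤s z≤n)) , consecAdj-applyUpTo G (f ∘ suc) (suc k) (h ∘ s≤s)

  standard-Hamiltonian : 2 ≤ m → (G : Graph n) → (∀ {i} → i < n → Adj G (vtx i) (vtx (suc i))) → Hamiltonian G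
  standard-Hamiltonian 2≤m G adj = s≤s 2≤m , applyUpTo vtx n , Perm.↭-reflexive standard-allFin ,
    subst (consecAdj G) (sym closed) (consecAdj-applyUpTo G vtx (suc n) (λ h → adj (s≤s⁻¹ h)))
    where
    closed : applyUpTo vtx n ++ [ vtx 0 ] ≡ applyUpTo vtx (suc n)
    closed = trans (cong (λ v → applyUpTo vtx n ++ [ v ]) (sym (vtx-n standardOrder 2≤m))) (applyUpTo-∷ʳ vtx n)

module _ {m : ℕ} (C : CyclicOrder m) (2≤m : 2 ≤ m) where
  open CyclicOrder C
  private n = suc m

  vtx-≢ : ∀ {p q} → p < q → q < n → vtx p ≢ vtx q
  vtx-≢ p<q q<n e = <⇒≢ p<q (vtx-injective C 2≤m (<-trans p<q q<n) q<n e)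

  vtx-≢-suc : ∀ {i} → i < n → vtx i ≢ vtx (suc i)
  vtx-≢-suc {i} i<n e with vtx-suc-injective C 2≤m i<n i<n e
  ... | inj₁ (f , _) = 1+n≢n (sym f)
  ... | inj₂ (f , g) = <⇒≱ 2≤m (≤-trans (≤-reflexive (trans (sym g) f)) z≤n)

  -- The hypotheses on p and q say that they are not neighbours on the cycle, neither directly nor
  -- across position 0.
  chord∉cycle : ∀ {p q} → suc p < q → q < n → suc q < n + p → mk (vtx p) (vtx q) ∉ map cycleEdge (downFrom n)
  chord∉cycle {p} {q} sp<q q<n wrap k with ∈-map⁻ cycleEdge k
  ... | i , i∈ , e = clash (mk-injective e)
    where
    i<n = ∈-downFrom⁻ i∈
    p<n = <-trans (<-trans (n<1+n p) sp<q) q<n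
    clash : (vtx p ≡ vtx i × vtx q ≡ vtx (suc i)) ⊎ (vtx p ≡ vtx (suc i) × vtx q ≡ vtx i) → ⊥
    clash (inj₁ (r , s)) with vtx-injective C 2≤m p<n i<n r
    ... | refl = vtx-≢ sp<q q<n (sym s)
    clash (inj₂ (r , s)) with vtx-injective C 2≤m q<n i<n s
    ... | refl with vtx-suc-injective C 2≤m p<n q<n r
    ...   | inj₁ (f , _) = <-asym (<-trans (n<1+n p) sp<q) (≤-reflexive (sym f))
    ...   | inj₂ (refl , refl) = <-irrefl (sym (+-identityʳ n)) wrap

-- Positive segment lengths make the four chord ends distinct and the ends of each chord
-- non-neighbours on the cycle, so the graph is simple.
module TypeAGraph (m w x y z : ℕ) (sum : w + x + y + z ≡ suc m) (pos : Positive (w , x , y , z)) where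

  private
    n = suc m
    w≥1 = proj₁ (proj₁ pos)
    x≥1 = proj₂ (proj₁ pos)
    y≥1 = proj₁ (proj₂ pos)
    z≥1 = proj₂ (proj₂ pos)

    2≤m : 2 ≤ m
    2≤m = s≤s⁻¹ (≤-trans (+-mono-≤ (+-mono-≤ w≥1 x≥1) y≥1) (≤-trans (m≤m+n (w + x + y) z) (≤-reflexive sum)))

    C = standardOrder m
    open CyclicOrder C

    a b c d : ℕ
    a = 0
    b = w + x
    c = w
    d = w + x + y

    +-< : ∀ i {j} → 1 ≤ j → i < i + j
    +-< i h = ≤-trans (≤-reflexive (+-comm 1 i)) (+-monoʳ-≤ i h)

    d<n : d < n
    d<n = ≤-trans (+-< d z≥1) (≤-reflexive sum)
    b<d : b < d
    b<d = +-< b y≥1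
    c<b : c < b
    c<b = +-< c x≥1
    b<n = <-trans b<d d<n
    c<n = <-trans c<b b<n

    e₁ = mk (vtx a) (vtx b)
    e₂ = mk (vtx c) (vtx d)
    cycle = map cycleEdge (downFrom n)

    e₁∉cycle : e₁ ∉ cycle
    e₁∉cycle = chord∉cycle C 2≤m (+-mono-≤ w≥1 x≥1) b<n (≤-trans (s≤s b<d) (≤-trans d<n (m≤m+n n 0)))

    e₂∉cycle : e₂ ∉ cycle
    e₂∉cycle = chord∉cycle C 2≤m (≤-trans (s≤s c<b) b<d) d<n (≤-trans (s≤s d<n) (+-< n w≥1))

    e₁≢e₂ : e₁ ≢ e₂
    e₁≢e₂ e with mk-injective e
    ... | inj₁ (p , _) = vtx-≢ C 2≤m w≥1 c<n p
    ... | inj₂ (p , _) = vtx-≢ C 2≤m (≤-trans w≥1 (<⇒≤ (<-trans c<b b<d))) d<n p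

  graph : Graph n
  graph = record
    { edges   = e₁ ∷ e₂ ∷ cycle
    ; ordered = mk-ordered (vtx-≢ C 2≤m (≤-trans w≥1 (<⇒≤ c<b)) b<n) ∷ mk-ordered (vtx-≢ C 2≤m (<-trans c<b b<d) d<n)
              ∷ Allₚ.map⁺ (All.tabulate λ k → mk-ordered (vtx-≢-suc C 2≤m (∈-downFrom⁻ k)))
    ; nodup   = (e₁≢e₂ ∷ Allₚ.¬Any⇒All¬ cycle e₁∉cycle) ∷ Allₚ.¬Any⇒All¬ cycle e₂∉cycle ∷ Unique-cycleEdges C 2≤m
    }

  presented : Presented graph
  presented = record
    { order = C ; a = a ; b = b ; c = c ; d = d ; a< = s≤s z≤n ; b< = b<n ; c< = c<n ; d< = d<n ; edges↭ = ↭-refl }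

  hamiltonian : Hamiltonian graph
  hamiltonian = standard-Hamiltonian m 2≤m graph λ {i} h →
    mk∈⇒Adj graph (there (there (∈-map⁺ cycleEdge (∈-downFrom⁺ h))))

  size-graph : ∣E∣ graph ≡ n + 2
  size-graph = trans (cong (2 +_) (trans (length-map cycleEdge (downFrom n)) (length-downFrom n))) (+-comm 2 n)

  count-graph : cnt (connected? n) (edges graph) ≡ value w x y z + 4 * suc n
  count-graph = trans (count-presented {G = graph} presented) (cong (_+ 4 * suc n) (values
      (crossing-occ {0} {b} {c} {d} {n} {w} {x} {y} {z} (sym (+-identityʳ w)) (+-comm w x)
                    (+-comm (w + x) y) (trans (sym sum) (+-comm d z)))))
    where
    values : ∀ {p q r s} → p ≡ z + 0 × q ≡ w × r ≡ x × s ≡ y → value p q r s ≡ value w x y z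
    -- Class 00 is the segment z closing the cycle, so the classes come as z, w, x, y.
    values (refl , refl , refl , refl) =
      trans (cong (λ z → value z w x y) (+-identityʳ z)) (value-rotate z w x y)

-- The number of vertices is a variable tied down by an equation, so that it can be matched as a
-- successor.
reliable⇒IsoTo : ∀ n k → 1 ≤ k → ∀ α → n ≡ 4 * k + toℕ α → (G : Graph n) → UniformlyMostReliable (n + 2) G →
                 IsoTo G (TypeAAdj n (cpaths k α))
reliable⇒IsoTo zero    (suc k) 1≤k α ()
reliable⇒IsoTo (suc m) k 1≤k α en G umr@((ham , size) , _) = iso (count-max⇒TypeA {G = G} k 1≤k α en (present G ham size)
    (≤-trans (≤-reflexive (sym T.count-graph)) (reliable⇒cnt-max {G = G} umr T.graph T.hamiltonian T.size-graph)))
  where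
  q = cpaths k α
  module T = TypeAGraph m (proj₁ q) (proj₁ (proj₂ q)) (proj₁ (proj₂ (proj₂ q))) (proj₂ (proj₂ (proj₂ q))) (trans (cpaths-sum k α) (sym en)) (cpaths-positive 1≤k α)
  iso : TypeA G (cpaths k α) → IsoTo G (TypeAAdj (suc m) (cpaths k α))
  iso (C , _ , adj) = typeA⇒IsoTo C {G} {proj₁ q} {proj₁ (proj₂ q)} {proj₁ (proj₂ (proj₂ q))} {proj₂ (proj₂ (proj₂ q))} adj

theorem2 : (k : ℕ) → 1 ≤ k → (α : Fin 4) →
    (G : Graph (4 * k + toℕ α)) →
    UniformlyMostReliable (4 * k + toℕ α + 2) G →
    IsoTo G (TypeAAdj (4 * k + toℕ α) (cpaths k α))
theorem2 k 1≤k α = reliable⇒IsoTo (4 * k + toℕ α) k 1≤k α refl
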